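{- Let $P_\ell$ denote the path with $\ell$ edges, and let $k^*(P_\ell,2)$ be the smallest integer $k$ for which Builder has a winning strategy in the deterministic $P_\ell$-avoidance game with $2$ colors and tree size restriction $k$. Then, as $\ell\to\infty$, \[ (8/15+o(1))\cdot \ell^2 \;\leq\; k^*(P_\ell,2)\;\leq\; O\big(\ell^{2\log_2(1+\sqrt{3})}\big). \]
   Context: Deterministic $F$-avoidance game with $r$ colors and tree size restriction $k$: two players Builder and Painter play on a board with $a$ vertices, initially without edges. In each step Builder presents a new edge, which Painter must immediately color with one of $r$ colors; Painter loses as soon as a monochromatic copy of $F$ is created. Builder must never create a cycle on the board nor a component (tree) with more than $k$ edges. Builder has a winning strategy if for some large enough $a$ he can force Painter to create a monochromatic copy of $F$ on a board with $a$ vertices. Note $2\log_2(1+\sqrt3)=2.899\ldots$. -}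

module Defs where

open import Data.Nat using (ℕ; zero; suc; _+_; _*_; _^_; _≤_; _<_)
open import Data.Fin using (Fin; inject₁) renaming (suc to fsuc)
open import Data.Product using (Σ; ∃; ∃-syntax; _×_; _,_; proj₁)
open import Data.Sum using (_⊎_)
open import Data.List using (List; []; _∷_; length; lookup)
open import Data.List.Membership.Propositional using (_∈_)
open import Data.List.Relation.Unary.All using (All)
open import Data.List.Relation.Unary.Unique.Propositional using (Unique)
open import Relation.Nullary using (¬_)
open import Function.Definitions using (Injective)
open import Relation.Binary.PropositionalEquality using (_≡_)

-- Boards: a vertices, edges coloured with one of r colours.
-- A coloured edge is (u , v , c); edges are undirected.

ColEdge : ℕ → ℕ → Set
ColEdge a r = Fin a × Fin a × Fin r

Board : ℕ → ℕ → Set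
Board a r = List (ColEdge a r)

HasEdge : ∀ {a r} → Board a r → Fin r → Fin a → Fin a → Set
HasEdge E c u v = ((u , v , c) ∈ E) ⊎ ((v , u , c) ∈ E)

Adj : ∀ {a r} → Board a r → Fin a → Fin a → Set
Adj E u v = ∃[ c ] HasEdge E c u v

data Reach {a r} (E : Board a r) : Fin a → Fin a → Set where
  here : ∀ {u} → Reach E u u
  step : ∀ {u w v} → Adj E u w → Reach E w v → Reach E u v

-- Every component of the board has at most k edges: any collection of
-- distinct edges (identified by their position in the board) lying in
-- the component of a vertex w has size ≤ k.
ComponentsAtMost : ∀ {a r} → ℕ → Board a r → Set
ComponentsAtMost k E =
  ∀ (w : Fin _) (L : List (Fin (length E))) → Unique L →
  All (λ i → Reach E w (proj₁ (lookup E i))) L → length L ≤ k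

MonoPath : ∀ {a r} → ℕ → Board a r → Set
MonoPath {a} {r} ℓ E =
  Σ (Fin r) λ c → Σ (Fin (suc ℓ) → Fin a) λ f →
    Injective _≡_ _≡_ f × (∀ (i : Fin ℓ) → HasEdge E c (f (inject₁ i)) (f (fsuc i)))

-- Builder wins from board E (P_ℓ-avoidance game, r colours, tree size
-- restriction k): either Painter has already created a monochromatic P_ℓ,
-- or Builder can present a new edge uv which creates no cycle (u,v not
-- yet connected) and no component with more than k edges, such that
-- whatever colour Painter chooses, Builder wins from the resulting board.
-- (The game is finite, so this inductive predicate = existence of a
-- winning strategy.)
data BuilderWinsFrom (ℓ k r : ℕ) {a : ℕ} : Board a r → Set where
  painterLost : ∀ {E} → MonoPath ℓ E → BuilderWinsFrom ℓ k r E
  present : ∀ {E} (u v : Fin a) →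
            ¬ Reach E u v →
            (∀ (c : Fin r) → ComponentsAtMost k ((u , v , c) ∷ E)) →
            (∀ (c : Fin r) → BuilderWinsFrom ℓ k r ((u , v , c) ∷ E)) →
            BuilderWinsFrom ℓ k r E

BuilderWins : (ℓ k r : ℕ) → Set
BuilderWins ℓ k r = ∃[ a ] BuilderWinsFrom ℓ k r {a} []

-- The exponent α = 2 log₂(1+√3).  (1+√3)² = 4+2√3, and
-- (4+2√3)^b = xs b + ys b · √3.

xs ys : ℕ → ℕ
xs zero = 1
xs (suc b) = 4 * xs b + 6 * ys b
ys zero = 0
ys (suc b) = 2 * xs b + 4 * ys b

-- n > x + y√3  (all quantities natural), decided via integers
GtSurd : ℕ → ℕ → ℕ → Set
GtSurd n x y = Σ ℕ λ d → (n ≡ x + suc d) × (3 * (y * y) < suc d * suc d)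

-- a/b > α   ⇔   2^a > (4+2√3)^b
AboveAlpha : ℕ → ℕ → Set
AboveAlpha a b = GtSurd (2 ^ a) (xs b) (ys b)

-- k ≤ C · ℓ^α   ⇔   for every rational a/b > α (b ≥ 1): k ≤ C · ℓ^(a/b),
-- i.e. k^b ≤ C^b · ℓ^a.
LeCPowAlpha : ℕ → ℕ → ℕ → Set
LeCPowAlpha C ℓ k = ∀ (a b : ℕ) → AboveAlpha a (suc b) → k ^ suc b ≤ C ^ suc b * ℓ ^ a

{-# OPTIONS --safe #-}
-- Lower bound. Painter colours an edge red if this creates no red P₂, else blue if it creates no blue
-- P₄, else red if it creates no red P_ℓ, else blue.  Then any four consecutive edges of a blue path
-- include one whose endpoints start red paths of total length ℓ − 1, so a blue P_ℓ carries about ℓ/5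
-- disjoint pairs of such red paths.  On a red path no two adjacent edges were of the first sort; an edge
-- of the third sort has at least 4, and two adjacent ones at least 5, further edges hanging from their
-- endpoints, because a blue P₄ had to be threatened there and every blue edge needs an adjacent red one.
-- So red paths cost 8/3 edges per unit of length, and the component has about (ℓ/5)(8/3)ℓ edges.
--
-- Upper bound. Joining the end of a red path of length s to the end of a blue path of length t yields,
-- whatever the colour, a vertex starting both; joining two such vertices yields a red path of length
-- 2s + 1 or a blue one of length 2t + 1.  If the paths cost R and B edges, the new one costs 2R + 2B + 3,
-- so after n doublings the cost is that of the recursion z(n+2) = 2 z(n+1) + 2 z(n), of growth rate
-- 1 + √3, and fewer than 2 log₂(ℓ + 1) + 2 doublings are needed.
module Submission where

open import Defs
open import Data.Nat using (ℕ; zero; suc; _+_; _*_; _^_; _≤_; _<_; z≤n; s≤s; s≤s⁻¹; _≤′_; ≤′-refl; ≤′-step)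
open import Data.Nat.Properties
open import Data.Nat.DivMod using (_/_; m/n*n≤m; m≡m%n+[m/n]*n; m%n<n)
open import Data.Nat.Tactic.RingSolver using (solve-∀)
open import Data.Fin using (Fin; zero; suc; inject₁; toℕ)
open import Data.Fin.Properties using () renaming (suc-injective to Fin-suc-injective)
open import Data.Product using (∃-syntax; ∃₂; _×_; _,_; proj₁; proj₂)
open import Data.Sum using (_⊎_; inj₁; inj₂; [_,_]′)
open import Data.Unit using (⊤; tt)
open import Data.Empty using (⊥; ⊥-elim)
open import Data.List using (List; []; _∷_; _++_; length; lookup; map; replicate; tabulate; _ʳ++_)
open import Data.List.Properties using (length-++; length-ʳ++; ++-assoc; ++-identityʳ; ∷-injectiveʳ)
open import Data.List.Membership.Propositional using (_∈_; _∉_)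
open import Data.List.Membership.Propositional.Properties using (∈-++⁻; ∈-++⁺ˡ; ∈-++⁺ʳ)
open import Data.List.Relation.Unary.All as All using (All; []; _∷_)
open import Data.List.Relation.Unary.All.Properties using ()
  renaming (++⁺ to All-++⁺; ++⁻ˡ to All-++⁻ˡ; tabulate⁺ to All-tabulate⁺)
open import Data.List.Relation.Unary.Any using (here; there)
open import Data.List.Relation.Unary.AllPairs using (AllPairs; []; _∷_)
open import Data.List.Relation.Unary.AllPairs.Properties using () renaming (tabulate⁺ to AllPairs-tabulate⁺)
open import Data.List.Relation.Unary.Unique.Propositional using (Unique)
open import Data.List.Relation.Unary.Unique.Propositional.Properties using () renaming (++⁺ to Unique-++⁺)
open import Data.List.Relation.Binary.Permutation.Propositional using
  (_↭_; ↭-refl; ↭-prep; ↭-swap; ↭-trans; ↭-sym; ↭⇒↭ₛ)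
open import Data.List.Relation.Binary.Permutation.Propositional.Properties using
  (All-resp-↭; ↭-map-inv; ++-comm; shift) renaming (++⁺ˡ to ↭-++⁺ˡ)
import Data.List.Relation.Binary.Permutation.Setoid.Properties as SetoidPermutation
open import Relation.Nullary using (¬_)
open import Relation.Nullary.Decidable using (decidable-stable)
open import Relation.Binary.Definitions using (tri<; tri≈; tri>)
open import Relation.Binary.PropositionalEquality using (_≡_; _≢_; refl; sym; trans; cong; cong₂; subst; setoid; resp₂)
open import Function using (_∘_; id)

-- Forests and subtrees

pattern red  = zero
pattern blue = suc zero

-- An edge is identified by the number of edges that were on the board when it was presented.
data Edge {a r} : Board a r → ℕ → Fin a → Fin a → Fin r → Set where
  new  : ∀ {E u v c} → Edge ((u , v , c) ∷ E) (length E) u v c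
  new⁻ : ∀ {E u v c} → Edge ((u , v , c) ∷ E) (length E) v u c
  old  : ∀ {e E i x y c} → Edge E i x y c → Edge (e ∷ E) i x y c

-- With `P` as the set of permitted edges, one type serves for walks avoiding a given edge and for
-- walks inside a given subtree.
data Walk {a r} (E : Board a r) (P : ℕ → Set) : Fin a → Fin a → Set where
  stop : ∀ {x} → Walk E P x x
  hop  : ∀ {x w y i c} → Edge E i x w c → P i → Walk E P w y → Walk E P x y

-- Every edge is a bridge. In terms of edge indices this excludes loops and parallel edges along
-- with longer cycles.
Forest : ∀ {a r} → Board a r → Set
Forest E = ∀ {i x y c} → Edge E i x y c → ¬ Walk E (_≢ i) x y

module _ {a r : ℕ} where

  edge-sym : ∀ {E : Board a r} {i x y c} → Edge E i x y c → Edge E i y x c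
  edge-sym new     = new⁻
  edge-sym new⁻    = new
  edge-sym (old e) = old (edge-sym e)

  edge-< : ∀ {E : Board a r} {i x y c} → Edge E i x y c → i < length E
  edge-< new     = ≤-refl
  edge-< new⁻    = ≤-refl
  edge-< (old e) = m<n⇒m<1+n (edge-< e)

  edge-unique : ∀ {E : Board a r} {i x y c x′ y′ c′} → Edge E i x y c → Edge E i x′ y′ c′ →
                c ≡ c′ × ((x ≡ x′ × y ≡ y′) ⊎ (x ≡ y′ × y ≡ x′))
  edge-unique new     new      = refl , inj₁ (refl , refl)
  edge-unique new     new⁻     = refl , inj₂ (refl , refl)
  edge-unique new     (old f)  = ⊥-elim (<-irrefl refl (edge-< f))
  edge-unique new⁻    new      = refl , inj₂ (refl , refl)
  edge-unique new⁻    new⁻     = refl , inj₁ (refl , refl)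
  edge-unique new⁻    (old f)  = ⊥-elim (<-irrefl refl (edge-< f))
  edge-unique (old e) new      = ⊥-elim (<-irrefl refl (edge-< e))
  edge-unique (old e) new⁻     = ⊥-elim (<-irrefl refl (edge-< e))
  edge-unique (old e) (old f)  = edge-unique e f

  edge-older : ∀ {E : Board a r} {e i x y c} → Edge (e ∷ E) i x y c → i < length E → Edge E i x y c
  edge-older new     p = ⊥-elim (<-irrefl refl p)
  edge-older new⁻    p = ⊥-elim (<-irrefl refl p)
  edge-older (old e) p = e

  ∈⇒edge : ∀ {E : Board a r} {x y c} → (x , y , c) ∈ E → ∃[ i ] Edge E i x y c
  ∈⇒edge (here refl) = _ , new
  ∈⇒edge (there p)   = _ , old (proj₂ (∈⇒edge p))

  hasEdge⇒edge : ∀ {E : Board a r} {x y c} → HasEdge E c x y → ∃[ i ] Edge E i x y c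
  hasEdge⇒edge (inj₁ p) = ∈⇒edge p
  hasEdge⇒edge (inj₂ p) = _ , edge-sym (proj₂ (∈⇒edge p))

  edge⇒hasEdge : ∀ {E : Board a r} {i x y c} → Edge E i x y c → HasEdge E c x y
  edge⇒hasEdge new     = inj₁ (here refl)
  edge⇒hasEdge new⁻    = inj₂ (here refl)
  edge⇒hasEdge (old e) with edge⇒hasEdge e
  ... | inj₁ p = inj₁ (there p)
  ... | inj₂ p = inj₂ (there p)

  -- Indices count from the oldest edge, `lookup` counts from the newest.
  edge-position : ∀ {E : Board a r} {i x y c} → Edge E i x y c →
                  ∃[ p ] (lookup E p ≡ (x , y , c) ⊎ lookup E p ≡ (y , x , c)) ×
                         suc (toℕ p + i) ≡ length E
  edge-position new     = zero , inj₁ refl , refl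
  edge-position new⁻    = zero , inj₂ refl , refl
  edge-position (old e) with edge-position e
  ... | p , q , eq = suc p , q , cong suc eq

  walk-map : ∀ {E : Board a r} {P Q : ℕ → Set} {x y} → (∀ {i} → P i → Q i) → Walk E P x y → Walk E Q x y
  walk-map f stop        = stop
  walk-map f (hop e p w) = hop e (f p) (walk-map f w)

  loosen : ∀ {E : Board a r} {P x y} → Walk E P x y → Walk E (λ _ → ⊤) x y
  loosen = walk-map _

  walk-trans : ∀ {E : Board a r} {P x y z} → Walk E P x y → Walk E P y z → Walk E P x z
  walk-trans stop        v = v
  walk-trans (hop e p w) v = hop e p (walk-trans w v)

  walk-sym : ∀ {E : Board a r} {P x y} → Walk E P x y → Walk E P y x
  walk-sym stop        = stop
  walk-sym (hop e p w) = walk-trans (walk-sym w) (hop (edge-sym e) p stop)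

  walk⇒reach : ∀ {E : Board a r} {P x y} → Walk E P x y → Reach E x y
  walk⇒reach stop        = here
  walk⇒reach (hop e _ w) = step (_ , edge⇒hasEdge e) (walk⇒reach w)

  -- Everything between the first and the last crossing of the new edge is cut out; if these two run
  -- in opposite directions, the new edge disappears altogether.
  walk-older : ∀ {E : Board a r} {u v c P x y} → Walk ((u , v , c) ∷ E) P x y →
               Walk E P x y ⊎ (Walk E P x u × Walk E P v y) ⊎ (Walk E P x v × Walk E P u y)
  walk-older stop = inj₁ stop
  walk-older (hop new p w) with walk-older w
  ... | inj₁ q               = inj₂ (inj₁ (stop , q))
  ... | inj₂ (inj₁ (q , q′)) = inj₂ (inj₁ (stop , q′))
  ... | inj₂ (inj₂ (q , q′)) = inj₁ q′
  walk-older (hop new⁻ p w) with walk-older w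
  ... | inj₁ q               = inj₂ (inj₂ (stop , q))
  ... | inj₂ (inj₁ (q , q′)) = inj₁ q′
  ... | inj₂ (inj₂ (q , q′)) = inj₂ (inj₂ (stop , q′))
  walk-older (hop (old e) p w) with walk-older w
  ... | inj₁ q               = inj₁ (hop e p q)
  ... | inj₂ (inj₁ (q , q′)) = inj₂ (inj₁ (hop e p q , q′))
  ... | inj₂ (inj₂ (q , q′)) = inj₂ (inj₂ (hop e p q , q′))

  walk-avoiding-new : ∀ {E : Board a r} {e x y} → Walk (e ∷ E) (_≢ length E) x y → Reach E x y
  walk-avoiding-new stop                = here
  walk-avoiding-new (hop new p w)       = ⊥-elim (p refl)
  walk-avoiding-new (hop new⁻ p w)      = ⊥-elim (p refl)
  walk-avoiding-new (hop (old e) p w)   = step (_ , edge⇒hasEdge e) (walk-avoiding-new w)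

  reach⇒walk : ∀ {E : Board a r} {x y} → Reach E x y → Walk E (λ _ → ⊤) x y
  reach⇒walk here              = stop
  reach⇒walk (step (_ , h) w) = hop (proj₂ (hasEdge⇒edge h)) _ (reach⇒walk w)

  reach-sym : ∀ {E : Board a r} {x y} → Reach E x y → Reach E y x
  reach-sym = walk⇒reach ∘ walk-sym ∘ reach⇒walk

  forest-∷ : ∀ {E : Board a r} {u v c} → Forest E → ¬ Reach E u v → Forest ((u , v , c) ∷ E)
  forest-∷ F ¬uv new     w = ¬uv (walk-avoiding-new w)
  forest-∷ F ¬uv new⁻    w = ¬uv (reach-sym (walk-avoiding-new w))
  -- A way around an old edge that uses the new one would, together with that old edge, have joined
  -- `u` to `v` beforehand.
  forest-∷ F ¬uv (old e) w with walk-older w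
  ... | inj₁ q = F e q
  ... | inj₂ (inj₁ (q , q′)) =
    ¬uv (walk⇒reach (walk-trans (walk-sym (loosen q)) (hop e _ (walk-sym (loosen q′)))))
  ... | inj₂ (inj₂ (q , q′)) =
    ¬uv (walk⇒reach (walk-trans (loosen q′) (hop (edge-sym e) _ (loosen q))))

-- A subtree rooted at x, given with the edges at its root and its number of edges; only
-- adjacent edges are required to differ, which in a forest makes all its edges distinct.
data Branching {a r} (E : Board a r) : Fin a → List ℕ → ℕ → Set where
  leaf  : ∀ {x} → Branching E x [] 0
  graft : ∀ {x y i c R S m n} → Edge E i x y c →
          Branching E y R m → All (_≢ i) R → Branching E x S n → All (_≢ i) S →
          Branching E x (i ∷ S) (suc (m + n))

module _ {a r : ℕ} {E : Board a r} where

  edges : ∀ {x R n} → Branching E x R n → List ℕ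
  edges leaf                          = []
  edges (graft {i = i} _ s _ t _)     = i ∷ edges s ++ edges t

  length-edges : ∀ {x R n} (t : Branching E x R n) → length (edges t) ≡ n
  length-edges leaf              = refl
  length-edges (graft _ s _ t _) =
    cong suc (trans (length-++ (edges s)) (cong₂ _+_ (length-edges s) (length-edges t)))

  Near : List ℕ → Fin a → ℕ → Set
  Near L x i = ∃[ y ] ∃[ z ] ∃[ c ] Edge E i y z c × Walk E (_∈ L) x y

  edges-near : ∀ {x R n} (t : Branching E x R n) → All (Near (edges t) x) (edges t)
  edges-near leaf = []
  edges-near (graft e s _ t _) =
    (_ , _ , _ , e , stop) ∷
    All-++⁺ (All.map (λ (_ , _ , _ , f , w) → _ , _ , _ , f ,
               hop e (here refl) (walk-map (there ∘ ∈-++⁺ˡ) w)) (edges-near s))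
            (All.map (λ (_ , _ , _ , f , w) → _ , _ , _ , f ,
               walk-map (there ∘ ∈-++⁺ʳ (edges s)) w) (edges-near t))

  ∉⇒avoid : ∀ {L : List ℕ} {i j} → i ∉ L → j ∈ L → j ≢ i
  ∉⇒avoid i∉L j∈L refl = i∉L j∈L

  near-end : ∀ {P : ℕ → Set} {i x y z y′ z′ c c′} → P i → Edge E i y z c → Edge E i y′ z′ c′ →
             Walk E P x y → Walk E P x y′
  near-end p e f w with edge-unique e f
  ... | _ , inj₁ (refl , refl) = w
  ... | _ , inj₂ (refl , refl) = walk-trans w (hop e p stop)

  module _ (F : Forest E) where

    -- If the branch behind another root edge `j` contained `i`, then walking through it to `i`
    -- would lead back to the root without `j`, so `j` would not be a bridge.
    edges-avoid : ∀ {x R n i y c} (t : Branching E x R n) → Edge E i x y c → All (_≢ i) R → i ∉ edges t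
    edges-avoid (graft e s p t q) f (j≢i ∷ _) (here refl) = j≢i refl
    edges-avoid {i = i} (graft {i = j} e s p t q) f (j≢i ∷ u) (there i∈) with ∈-++⁻ (edges s) i∈
    ... | inj₂ i∈t = edges-avoid t f u i∈t
    ... | inj₁ i∈s with All.lookup (edges-near s) i∈s
    ...   | _ , _ , _ , g , w =
      F e (walk-sym (near-end (j≢i ∘ sym) g f (walk-map (∉⇒avoid (edges-avoid s (edge-sym e) p)) w)))

    edges-unique : ∀ {x R n} (t : Branching E x R n) → Unique (edges t)
    edges-unique leaf = []
    edges-unique (graft {i = i} e s p t q) =
      All.tabulate (λ j∈ i≡j → i∉st (subst (_∈ _) (sym i≡j) j∈)) ∷
      Unique-++⁺ (edges-unique s) (edges-unique t) disj
      where
      i∉s = edges-avoid s (edge-sym e) p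
      i∉t = edges-avoid t e q
      i∉st : i ∉ edges s ++ edges t
      i∉st i∈ = [ i∉s , i∉t ]′ (∈-++⁻ (edges s) i∈)
      disj : ∀ {j} → ¬ (j ∈ edges s × j ∈ edges t)
      disj (j∈s , j∈t) with All.lookup (edges-near s) j∈s | All.lookup (edges-near t) j∈t
      ... | _ , _ , _ , f , w | _ , _ , _ , g , w′ =
        F e (walk-trans (walk-map (∉⇒avoid i∉t) w′)
               (walk-sym (near-end (∉⇒avoid i∉s j∈s) f g (walk-map (∉⇒avoid i∉s) w))))

  -- Links subtrees, whose edges are indices, to `ComponentsAtMost`, which counts positions on the
  -- board.
  positions : ∀ {x} (L : List ℕ) → Unique L →
              All (λ i → ∃[ y ] ∃[ z ] ∃[ c ] Edge E i y z c × Reach E x y) L →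
              ∃[ ps ] length ps ≡ length L × Unique ps × All (λ p → Reach E x (proj₁ (lookup E p))) ps ×
                      All (λ p → ∃[ i ] i ∈ L × suc (toℕ p + i) ≡ length E) ps
  positions [] _ _ = [] , refl , [] , [] , []
  positions {x} (i ∷ L) (i≢ ∷ U) ((y , z , c , e , w) ∷ N)
    with positions L U N | edge-position e
  ... | ps , len , V , R , T | p , at , eq =
    p ∷ ps , cong suc len , fresh ∷ V , reach at ∷ R ,
    (i , here refl , eq) ∷ All.map (λ (j , j∈ , q) → j , there j∈ , q) T
    where
    fresh : All (p ≢_) ps
    fresh = All.map (λ { (j , j∈ , q) refl →
      All.lookup i≢ j∈ (+-cancelˡ-≡ (toℕ p) i j (suc-injective (trans eq (sym q)))) }) T
    reach : lookup E p ≡ (y , z , c) ⊎ lookup E p ≡ (z , y , c) → Reach E x (proj₁ (lookup E p))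
    reach (inj₁ q) rewrite q = w
    reach (inj₂ q) rewrite q = walk⇒reach (walk-trans (reach⇒walk w) (hop e _ stop))

  branching-≤ : ∀ {k x R n} → Forest E → ComponentsAtMost k E → Branching E x R n → n ≤ k
  branching-≤ {k} F K t with positions (edges t) (edges-unique F t)
                         (All.map (λ (_ , _ , _ , e , w) → _ , _ , _ , e , walk⇒reach w) (edges-near t))
  ... | ps , len , U , R , _ = subst (_≤ k) (trans len (length-edges t)) (K _ ps U R)

-- Constraining the edges at the root suffices: grafting and merging check nothing deeper.
Tree : ∀ {a r} → Board a r → (ℕ → Set) → Fin a → ℕ → Set
Tree E P x n = ∃[ R ] Branching E x R n × All P R

module _ {a r : ℕ} {E : Board a r} where

  bare : ∀ {P x} → Tree E P x 0
  bare = [] , leaf , []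

  tree-map : ∀ {P Q x n} → (∀ {i} → P i → Q i) → Tree E P x n → Tree E Q x n
  tree-map f (R , t , p) = R , t , All.map f p

  extend : ∀ {i x y c n} → Edge E i x y c → Tree E (_≢ i) y n → Tree E (_≡ i) x (suc n)
  extend {n = n} e (R , t , p) = _ , subst (Branching E _ _) (cong suc (+-identityʳ n)) (graft e t p leaf []) , refl ∷ []

  merge : ∀ {P Q x m n} → (∀ {i} → P i → ¬ Q i) → Tree E P x m → Tree E Q x n →
          Tree E (λ i → P i ⊎ Q i) x (m + n)
  merge {P} {Q} {n = n} P⊥Q (R , s , p) (S , t , q) = R ++ S , go s p , All-++⁺ (All.map inj₁ p) (All.map inj₂ q)
    where
    go : ∀ {R m} → Branching E _ R m → All P R → Branching E _ (R ++ S) (m + n)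
    go leaf _ = t
    go (graft {m = m} {n = m′} e s₁ p₁ s₂ p₂) (p ∷ ps) =
      subst (Branching E _ _) (cong suc (sym (+-assoc m m′ n)))
        (graft e s₁ p₁ (go s₂ ps) (All-++⁺ p₂ (All.map (λ { q refl → P⊥Q p q }) q)))

-- Painter's strategy

-- Painter's rules are not decided. His choices are case distinctions under a double negation, which
-- is enough because the final claim is an inequality of numbers.
¬¬em : {A : Set} → ¬ ¬ (A ⊎ ¬ A)
¬¬em f = f (inj₂ (λ x → f (inj₁ x)))

-- Non-backtracking walks of n edges of colour c from x, all older than t and not starting with f.
data Arm {a r} (E : Board a r) (c : Fin r) (t : ℕ) : ℕ → Fin a → ℕ → Set where
  end  : ∀ {f x} → Arm E c t f x 0
  step : ∀ {f x y i n} → Edge E i x y c → i < t → i ≢ f → Arm E c t i y n → Arm E c t f x (suc n)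

-- For the edge `t` joining `u` and `v`: giving it colour `c` closes a path of `n + 1` edges, since
-- walks without backtracking in a forest are paths.
Arms : ∀ {a r} → Board a r → Fin r → ℕ → Fin a → Fin a → ℕ → Set
Arms E c t u v n = ∃[ m ] ∃[ m′ ] m + m′ ≡ n × Arm E c t t u m × Arm E c t t v m′

Touches : ∀ {a r} → Board a r → Fin r → ℕ → Fin a → Set
Touches E c t x = ∃[ i ] ∃[ y ] Edge E i x y c × i < t

Coloured : ∀ {a r} → Board a r → Fin r → ℕ → Set
Coloured E c i = ∃[ x ] ∃[ y ] Edge E i x y c

module _ {a r : ℕ} {E : Board a r} where

  arms-sym : ∀ {c t u v n} → Arms E c t u v n → Arms E c t v u n
  arms-sym (m , m′ , eq , A , B) = m′ , m , trans (+-comm m′ m) eq , B , A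

  arm-old : ∀ {e c t f x n} → Arm E c t f x n → Arm (e ∷ E) c t f x n
  arm-old end            = end
  arm-old (step e p q A) = step (old e) p q (arm-old A)

  arm-older : ∀ {e c t f x n} → t ≤ length E → Arm (e ∷ E) c t f x n → Arm E c t f x n
  arm-older t≤ end            = end
  arm-older t≤ (step e p q A) = step (edge-older e (<-≤-trans p t≤)) p q (arm-older t≤ A)

  arms-old : ∀ {e c t u v n} → Arms E c t u v n → Arms (e ∷ E) c t u v n
  arms-old (_ , _ , eq , A , B) = _ , _ , eq , arm-old A , arm-old B

  arms-older : ∀ {e c t u v n} → t ≤ length E → Arms (e ∷ E) c t u v n → Arms E c t u v n
  arms-older t≤ (_ , _ , eq , A , B) = _ , _ , eq , arm-older t≤ A , arm-older t≤ B

  touches-old : ∀ {e c t x} → Touches E c t x → Touches (e ∷ E) c t x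
  touches-old (i , y , e , p) = i , y , old e , p

  touches-older : ∀ {e c t x} → t ≤ length E → Touches (e ∷ E) c t x → Touches E c t x
  touches-older t≤ (i , y , e , p) = i , y , edge-older e (<-≤-trans p t≤) , p

  colours-differ : ∀ {c c′ i j} → c ≢ c′ → Coloured E c i → Coloured E c′ j → i ≢ j
  colours-differ c≢c′ (_ , _ , e) (_ , _ , f) refl = c≢c′ (proj₁ (edge-unique e f))

module _ {a : ℕ} where

  Isolated : Board a 2 → ℕ → Fin a → Fin a → Set
  Isolated E t u v = ¬ Touches E red t u × ¬ Touches E red t v

  -- The path to be avoided has `m + 1` edges. A red edge either is of the first sort, or would have
  -- closed a blue P₄.
  RedRule : ℕ → Board a 2 → ℕ → Fin a → Fin a → Set
  RedRule m E t u v = (Isolated E t u v ⊎ Arms E blue t u v 3) × ¬ Arms E red t u v m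

  BlueRule : ℕ → Board a 2 → ℕ → Fin a → Fin a → Set
  BlueRule m E t u v = (Touches E red t u ⊎ Touches E red t v) × (¬ Arms E blue t u v 3 ⊎ Arms E red t u v m)

  -- The boards that arise when Painter prefers, in this order: red without a red P₂, blue without
  -- a blue P₄, red without a red P_{m+1}, blue.
  record Painted (m : ℕ) (E : Board a 2) : Set where
    field
      forest   : Forest E
      redRule  : ∀ {t u v} → Edge E t u v red → RedRule m E t u v
      blueRule : ∀ {t u v} → Edge E t u v blue → BlueRule m E t u v
  open Painted

  redRule-sym : ∀ {m E t u v} → RedRule m E t u v → RedRule m E t v u
  redRule-sym (inj₁ (p , q) , n) = inj₁ (q , p) , n ∘ arms-sym
  redRule-sym (inj₂ b , n)       = inj₂ (arms-sym b) , n ∘ arms-sym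

  blueRule-sym : ∀ {m E t u v} → BlueRule m E t u v → BlueRule m E t v u
  blueRule-sym (p , q) = [ inj₂ , inj₁ ]′ p , [ (λ n → inj₁ (n ∘ arms-sym)) , inj₂ ∘ arms-sym ]′ q

  -- The rules for an edge speak only of edges older than it, so later moves cannot disturb them.
  redRule-old : ∀ {m E e t u v} → t ≤ length E → RedRule m E t u v → RedRule m (e ∷ E) t u v
  redRule-old t≤ (inj₁ (p , q) , n) =
    inj₁ (p ∘ touches-older t≤ , q ∘ touches-older t≤) , n ∘ arms-older t≤
  redRule-old t≤ (inj₂ b , n) = inj₂ (arms-old b) , n ∘ arms-older t≤

  blueRule-old : ∀ {m E e t u v} → t ≤ length E → BlueRule m E t u v → BlueRule m (e ∷ E) t u v
  blueRule-old t≤ (p , q) =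
    [ inj₁ ∘ touches-old , inj₂ ∘ touches-old ]′ p ,
    [ (λ n → inj₁ (n ∘ arms-older t≤)) , inj₂ ∘ arms-old ]′ q

  painted-[] : ∀ {m} → Painted m []
  painted-[] .forest ()
  painted-[] .redRule ()
  painted-[] .blueRule ()

  painted-red : ∀ {m E u v} → Painted m E → ¬ Reach E u v → RedRule m E (length E) u v →
                Painted m ((u , v , red) ∷ E)
  painted-red P ¬uv R .forest = forest-∷ (P .forest) ¬uv
  painted-red P ¬uv R .redRule new     = redRule-old ≤-refl R
  painted-red P ¬uv R .redRule new⁻    = redRule-old ≤-refl (redRule-sym R)
  painted-red P ¬uv R .redRule (old e) = redRule-old (<⇒≤ (edge-< e)) (P .redRule e)
  painted-red P ¬uv R .blueRule (old e) = blueRule-old (<⇒≤ (edge-< e)) (P .blueRule e)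

  painted-blue : ∀ {m E u v} → Painted m E → ¬ Reach E u v → BlueRule m E (length E) u v →
                 Painted m ((u , v , blue) ∷ E)
  painted-blue P ¬uv R .forest = forest-∷ (P .forest) ¬uv
  painted-blue P ¬uv R .blueRule new     = blueRule-old ≤-refl R
  painted-blue P ¬uv R .blueRule new⁻    = blueRule-old ≤-refl (blueRule-sym R)
  painted-blue P ¬uv R .blueRule (old e) = blueRule-old (<⇒≤ (edge-< e)) (P .blueRule e)
  painted-blue P ¬uv R .redRule (old e) = redRule-old (<⇒≤ (edge-< e)) (P .redRule e)

  isolated⇒short : ∀ {m E t u v} → Isolated E t u v → ¬ Arms E red t u v (suc m)
  isolated⇒short (p , q) (zero , _ , refl , _ , step e e< _ _) = q (_ , _ , e , e<)
  isolated⇒short (p , q) (suc _ , _ , _ , step e e< _ _ , _)   = p (_ , _ , e , e<)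

  -- The preferences cover all cases: an edge touching red goes blue unless that closes a blue P₄,
  -- then red unless that closes the long red path, then blue after all.
  painter-move : ∀ {m E u v} → Painted (suc m) E → ¬ Reach E u v →
                 ¬ Painted (suc m) ((u , v , red) ∷ E) → ¬ Painted (suc m) ((u , v , blue) ∷ E) → ⊥
  painter-move {m} {E} {u} {v} P ¬uv ¬red ¬blue =
    ¬¬em {Touches E red t u} λ tu → ¬¬em {Touches E red t v} λ tv →
    ¬¬em {Arms E blue t u v 3} λ b → ¬¬em {Arms E red t u v (suc m)} λ r → go tu tv b r
    where
    t = length E
    touched : Touches E red t u ⊎ Touches E red t v →
              Arms E blue t u v 3 ⊎ ¬ Arms E blue t u v 3 →
              Arms E red t u v (suc m) ⊎ ¬ Arms E red t u v (suc m) → ⊥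
    touched p (inj₂ ¬b) _         = ¬blue (painted-blue P ¬uv (p , inj₁ ¬b))
    touched p (inj₁ b)  (inj₁ r)  = ¬blue (painted-blue P ¬uv (p , inj₂ r))
    touched p (inj₁ b)  (inj₂ ¬r) = ¬red (painted-red P ¬uv (inj₂ b , ¬r))
    go : Touches E red t u ⊎ ¬ Touches E red t u → Touches E red t v ⊎ ¬ Touches E red t v → _ → _ → ⊥
    go (inj₁ p) _        = touched (inj₁ p)
    go (inj₂ _) (inj₁ q) = touched (inj₂ q)
    go (inj₂ p) (inj₂ q) _ _ = ¬red (painted-red P ¬uv (inj₁ (p , q) , isolated⇒short (p , q)))

  -- The edges that red paths force

  module _ {m : ℕ} {E : Board a 2} (P : Painted m E) where

    Red Blue : ℕ → Set
    Red  = Coloured E red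
    Blue = Coloured E blue

    red≢blue : ∀ {i j} → Red i → Blue j → i ≢ j
    red≢blue = colours-differ (λ ())

    blue≢red : ∀ {i j} → Blue i → Red j → i ≢ j
    blue≢red = colours-differ (λ ())

    ≡⇒blue : ∀ {i x y} → Edge E i x y blue → ∀ {j} → j ≡ i → Blue j
    ≡⇒blue e refl = _ , _ , e

    twig : ∀ {i x y c} → Edge E i x y c → Tree E (_≡ i) x 1
    twig e = extend e bare

    -- When the blue edge j was presented, one of its ends already had a red edge.
    with-red : ∀ {j x y n} → Edge E j x y blue → Tree E (λ i → i ≢ j × Blue i) y n →
               Tree E (λ i → i ≡ j ⊎ (Red i × i < j)) x (2 + n)
    with-red {n = n} e s with proj₁ (blueRule P e)
    -- The red edge may lie at the root `x` itself; it is then a root edge, recorded as older than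
    -- `j`.
    ... | inj₁ (k , z , f , k<j) =
      subst (Tree E _ _) (+-comm (suc n) 1)
      (tree-map [ inj₁ , (λ { refl → inj₂ ((_ , _ , f) , k<j) }) ]′
        (merge (λ { refl refl → <-irrefl refl k<j }) (extend e (tree-map proj₁ s)) (twig f)))
    ... | inj₂ (k , z , f , k<j) =
      tree-map inj₁
        (extend e (tree-map [ proj₁ , (λ { refl → <⇒≢ k<j }) ]′
          (subst (Tree E _ _) (+-comm n 1) (merge (λ { (_ , b) refl → red≢blue (_ , _ , f) b refl }) s (twig f)))))

    with-red⇒≢ : ∀ {i j l x y} → Edge E l x y blue → j ≢ l → i ≡ j ⊎ (Red i × i < j) → i ≢ l
    with-red⇒≢ e j≢l (inj₁ refl)    = j≢l
    with-red⇒≢ e j≢l (inj₂ (r , _)) = red≢blue r (_ , _ , e)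

    arm-1 : ∀ {t f x n} → Arm E blue t f x (1 + n) → Tree E Blue x 1
    arm-1 (step e _ _ _) = tree-map (≡⇒blue e) (twig e)

    -- The third edge is the red one beside the second blue edge. A red one beside the first may lie
    -- at `x` and belong to the red path, so it is left out.
    arm-2 : ∀ {t f x n} → Arm E blue t f x (2 + n) → Tree E Blue x 3
    arm-2 (step e₁ _ _ (step e₂ _ ≢₂ _)) =
      tree-map (≡⇒blue e₁) (extend e₁ (tree-map (with-red⇒≢ e₁ ≢₂) (with-red e₂ bare)))

    arm-3 : ∀ {t f x n} → Arm E blue t f x (3 + n) → Tree E Blue x 4
    arm-3 (step e₁ _ _ (step e₂ _ ≢₂ (step e₃ _ ≢₃ _))) =
      tree-map (≡⇒blue e₁) (extend e₁ (tree-map (with-red⇒≢ e₁ ≢₂)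
        (with-red e₂ (tree-map (λ { refl → ≢₃ , _ , _ , e₃ }) (twig e₃)))))

    Twigs : ℕ → Fin a → Fin a → Set
    Twigs n x y = ∃[ p ] ∃[ q ] n ≤ p + q × Tree E Blue x p × Tree E Blue y q

    arms-twigs : ∀ {t x y} → Arms E blue t x y 3 → Twigs 4 x y
    arms-twigs (0 , 3 , refl , _ , B) = 0 , 4 , ≤-refl , bare , arm-3 B
    arms-twigs (1 , 2 , refl , A , B) = 1 , 3 , ≤-refl , arm-1 A , arm-2 B
    arms-twigs (2 , 1 , refl , A , B) = 3 , 1 , ≤-refl , arm-2 A , arm-1 B
    arms-twigs (3 , 0 , refl , A , _) = 4 , 0 , ≤-refl , arm-3 A , bare

    Twigs₃ : (ℕ → Set) → Fin a → Fin a → Fin a → Set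
    Twigs₃ Q x y z = ∃[ p ] ∃[ q ] ∃[ r ] 5 ≤ p + q + r × Tree E Blue x p × Tree E Q y q × Tree E Blue z r

    -- An edge older than both `i` and `j` is neither of them, so even a red one may hang at their
    -- common vertex.
    Old : ℕ → ℕ → ℕ → Set
    Old i j k = Blue k ⊎ (k < i × k < j)

    old-red : ∀ {i j l x y} → Edge E l x y blue → l < i → i < j → ∀ {k} → k ≡ l ⊎ (Red k × k < l) → Old i j k
    old-red e l<i i<j (inj₁ refl)      = inj₁ (_ , _ , e)
    old-red e l<i i<j (inj₂ (_ , k<l)) = inj₂ (<-trans k<l l<i , <-trans k<l (<-trans l<i i<j))

    -- The blue arms of `i` at the common vertex `y` are older than `i`, so the red edge beside
    -- their first edge is older than `i` and `j` and counts even at `y`. If the arm of `i` at `y`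
    -- has length 2, the arms of `j` supply the fifth edge instead, at `z` or through a longer arm
    -- at `y`.
    arms-twigs₃ : ∀ {i j x y z} → i < j → Arms E blue i x y 3 → Arms E blue j y z 3 → Twigs₃ (Old i j) x y z
    arms-twigs₃ i<j (3 , 0 , refl , A , _) B′ with arms-twigs B′
    ... | p , q , 4≤ , s , t =
      4 , p , q , ≤-trans (s≤s 4≤) (+-monoˡ-≤ q (+-monoˡ-≤ p {1} {4} (s≤s z≤n))) , arm-3 A , tree-map inj₁ s , t
    arms-twigs₃ i<j (2 , 1 , refl , A , step e l<i _ end) B′ =
      3 , 2 , 0 , ≤-refl , arm-2 A , tree-map (old-red e l<i i<j) (with-red e bare) , bare
    arms-twigs₃ i<j (1 , 2 , refl , A , B) (_ , suc _ , _ , _ , C) =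
      1 , 3 , 1 , ≤-refl , arm-1 A , tree-map inj₁ (arm-2 B) , arm-1 C
    arms-twigs₃ i<j (1 , 2 , refl , A , _) (3 , zero , refl , B , _) =
      1 , 4 , 0 , ≤-refl , arm-1 A , tree-map inj₁ (arm-3 B) , bare
    arms-twigs₃ i<j (0 , 3 , refl , _ , step e₁ l<i _ (step e₂ _ ≢₂ (step e₃ _ ≢₃ end))) B′ =
      0 , 5 , 0 , ≤-refl , bare ,
      tree-map (old-red e₁ l<i i<j) (with-red e₁ (tree-map (λ { refl → ≢₂ , _ , _ , e₂ })
        (extend e₂ (tree-map (with-red⇒≢ e₂ ≢₃) (with-red e₃ bare))))) ,
      bare

    twigs₃ : ∀ {i j x y z} → i ≢ j → Arms E blue i x y 3 → Arms E blue j y z 3 → Twigs₃ (Old i j) x y z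
    twigs₃ {i} {j} i≢j A B with <-cmp i j
    ... | tri< i<j _ _ = arms-twigs₃ i<j A B
    ... | tri≈ _ i≡j _ = ⊥-elim (i≢j i≡j)
    ... | tri> _ _ j<i with arms-twigs₃ j<i (arms-sym B) (arms-sym A)
    ...   | p , q , r , 5≤ , s , t , u =
      r , q , p , subst (5 ≤_) (solve p q r) 5≤ , u ,
      tree-map [ inj₁ , (λ (k<j , k<i) → inj₂ (k<i , k<j)) ]′ t , s
      where
      solve : ∀ p q r → p + q + r ≡ r + q + p
      solve = solve-∀

    pass : ∀ {Q i x y c p n} → Edge E i x y c → (∀ {k} → Q k → k ≢ i) →
           Tree E Q x p → Tree E (_≢ i) y n → Tree E (λ k → Q k ⊎ k ≡ i) x (p + suc n)
    pass e Q⇒ s t = merge (λ { q refl → Q⇒ q refl }) s (extend e t)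

    First : ∀ {t f x n} → Arm E red t f x n → Set
    First end                              = ⊤
    First (step {x = x} {y} {i} e _ _ _)   = Arms E blue i x y 3

    -- Of two adjacent red edges the newer one met the older, so they cannot both be isolated.
    after-isolated : ∀ {i t w x n} → Edge E i w x red → Isolated E i w x → (A : Arm E red t i x n) → First A
    after-isolated e I end = tt
    after-isolated {i} e (_ , ¬x) (step {i = j} f _ j≢i A) with proj₁ (redRule P f)
    ... | inj₂ b = b
    ... | inj₁ (¬x′ , _) with <-cmp i j
    ...   | tri< i<j _ _ = ⊥-elim (¬x′ (_ , _ , edge-sym e , i<j))
    ...   | tri≈ _ i≡j _ = ⊥-elim (j≢i (sym i≡j))
    ...   | tri> _ _ j<i = ⊥-elim (¬x (_ , _ , f , j<i))

    -- The rate 8/3 without division; `d` absorbs the losses at the ends of the path.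
    record Costly (Q : ℕ → Set) (x : Fin a) (n d : ℕ) : Set where
      constructor costly
      field
        size  : ℕ
        bound : 8 * n ≤ 3 * size + d
        tree  : Tree E Q x size

    relax : ∀ {Q x n d d′} → d ≤ d′ → Costly Q x n d → Costly Q x n d′
    relax d≤ (costly k le t) = costly k (≤-trans le (+-monoʳ-≤ (3 * k) d≤)) t

    -- Two red edges with four further ones give 3 · 6 = 18, against the 8 · 2 = 16 required.
    two-steps : ∀ {f i j x y z n d} → Red f → i ≢ f → j ≢ i → Edge E i x y red → Edge E j y z red →
                Arms E blue i x y 3 → Costly (_≢ j) z n d → Costly (_≢ f) x (2 + n) d
    two-steps {n = n} {d} rf i≢f j≢i e₁ e₂ b (costly k le u) with arms-twigs b
    ... | p , q , 4≤ , s , t =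
      costly (p + suc (q + suc k)) bound
      (tree-map [ (λ b → blue≢red b rf) , (λ { refl → i≢f }) ]′
        (pass e₁ (λ b → blue≢red b (_ , _ , e₁)) s
          (tree-map [ (λ b → blue≢red b (_ , _ , e₁)) , (λ { refl → j≢i }) ]′
            (pass e₂ (λ b → blue≢red b (_ , _ , e₂)) t u))))
      where
      open ≤-Reasoning
      regroup : ∀ p q k d → 6 + 3 * (p + q) + (3 * k + d) ≡ 3 * (p + suc (q + suc k)) + d
      regroup = solve-∀
      bound : 8 * (2 + n) ≤ 3 * (p + suc (q + suc k)) + d
      bound = begin
        8 * (2 + n)                       ≡⟨ *-distribˡ-+ 8 2 n ⟩
        16 + 8 * n                        ≤⟨ +-mono-≤ (≤-trans (≤ᵇ⇒≤ 16 18 _) (+-monoʳ-≤ 6 (*-monoʳ-≤ 3 4≤))) le ⟩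
        6 + 3 * (p + q) + (3 * k + d)     ≡⟨ regroup p q k d ⟩
        3 * (p + suc (q + suc k)) + d     ∎

    -- Three red edges with five further ones give exactly 3 · 8 = 8 · 3: the tight case, which
    -- fixes the rate 8/3.
    three-steps : ∀ {f i j l x y z w n d} → Red f → i ≢ f → j ≢ i → l ≢ j →
                  Edge E i x y red → Edge E j y z red → Edge E l z w red →
                  Arms E blue i x y 3 → Arms E blue j y z 3 → Costly (_≢ l) w n d → Costly (_≢ f) x (3 + n) d
    three-steps {n = n} {d} rf i≢f j≢i l≢j e₁ e₂ e₃ b b′ (costly k le v) with twigs₃ (j≢i ∘ sym) b b′
    ... | p , q , r , 5≤ , s , t , u =
      costly (p + suc (q + suc (r + suc k))) bound
      (tree-map [ (λ b → blue≢red b rf) , (λ { refl → i≢f }) ]′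
        (pass e₁ (λ b → blue≢red b (_ , _ , e₁)) s
          (tree-map [ [ (λ b → blue≢red b (_ , _ , e₁)) , (λ (k<i , _) → <⇒≢ k<i) ]′ , (λ { refl → j≢i }) ]′
            (pass e₂ [ (λ b → blue≢red b (_ , _ , e₂)) , (λ (_ , k<j) → <⇒≢ k<j) ]′ t
              (tree-map [ (λ b → blue≢red b (_ , _ , e₂)) , (λ { refl → l≢j }) ]′
                (pass e₃ (λ b → blue≢red b (_ , _ , e₃)) u v))))))
      where
      open ≤-Reasoning
      regroup : ∀ p q r k d → 9 + 3 * (p + q + r) + (3 * k + d) ≡ 3 * (p + suc (q + suc (r + suc k))) + d
      regroup = solve-∀
      bound : 8 * (3 + n) ≤ 3 * (p + suc (q + suc (r + suc k))) + d
      bound = begin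
        8 * (3 + n)                             ≡⟨ *-distribˡ-+ 8 3 n ⟩
        24 + 8 * n                              ≤⟨ +-mono-≤ (+-monoʳ-≤ 9 (*-monoʳ-≤ 3 5≤)) le ⟩
        9 + 3 * (p + q + r) + (3 * k + d)       ≡⟨ regroup p q r k d ⟩
        3 * (p + suc (q + suc (r + suc k))) + d ∎

    -- The path is cut into blocks that begin with an edge of the third sort. A block has three
    -- edges when an isolated edge comes third, and two otherwise. Twigs are taken only at vertices
    -- before its last one, so blocks do not compete for them.
    red-run : ∀ n {t f x} → Red f → (A : Arm E red t f x n) → First A → Costly (_≢ f) x n 16
    -- At most two edges are left over at the end; 16 = 8 · 2 pays for them.
    red-run 0 rf end _ = costly 0 z≤n bare
    red-run 1 rf (step _ _ _ end) _ = costly 0 (≤ᵇ⇒≤ 8 16 _) bare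
    red-run 2 rf (step _ _ _ (step _ _ _ end)) _ = costly 0 ≤-refl bare
    red-run (suc (suc (suc n))) rf (step e₀ _ ≢₀ (step e₁ _ ≢₁ A@(step e₂ _ ≢₂ B))) b₀ =
      [ (λ I → two-steps rf ≢₀ ≢₁ e₀ e₁ b₀ (red-run (suc n) (_ , _ , e₁) A (after-isolated e₁ I A)))
      , (λ b₁ → [ (λ I → three-steps rf ≢₀ ≢₁ ≢₂ e₀ e₁ e₂ b₀ b₁ (red-run n (_ , _ , e₂) B (after-isolated e₂ I B)))
                , (λ b₂ → two-steps rf ≢₀ ≢₁ e₀ e₁ b₀ (red-run (suc n) (_ , _ , e₁) A b₂))
                ]′ (redRule P e₂ .proj₁))
      ]′ (redRule P e₁ .proj₁)

    one-step : ∀ {i x y n d Q} → Edge E i x y red → Costly (_≢ i) y n d → (∀ {k} → k ≡ i → Q k) →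
               Costly Q x (suc n) (8 + d)
    one-step {n = n} {d} e (costly k le t) q = costly (suc k) bound (tree-map q (extend e t))
      where
      open ≤-Reasoning
      regroup : ∀ k d → 8 + (3 * k + d) + 3 ≡ 3 * suc k + (8 + d)
      regroup = solve-∀
      bound : 8 * suc n ≤ 3 * suc k + (8 + d)
      bound = begin
        8 * suc n               ≡⟨ *-suc 8 n ⟩
        8 + 8 * n               ≤⟨ +-monoʳ-≤ 8 le ⟩
        8 + (3 * k + d)         ≤⟨ m≤m+n _ 3 ⟩
        8 + (3 * k + d) + 3     ≡⟨ regroup k d ⟩
        3 * suc k + (8 + d)     ∎

    -- The blue twigs at x itself are not counted: they may belong to a blue path through x.
    red-arm : ∀ {t f x n} → Arm E red t f x n → Costly Red x n 32
    red-arm end = costly 0 z≤n bare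
    red-arm (step e _ _ end) = costly 0 (≤ᵇ⇒≤ 8 32 _) bare
    red-arm (step e₀ _ _ A@(step e₁ _ ≢₁ B)) =
      -- Until an edge of the third sort can start a run, one or two edges are written off at 8
      -- each, so 32 = 16 + 8 + 8.
      [ (λ I → one-step e₀ (one-step e₁ (red-run _ (_ , _ , e₁) B (after-isolated e₁ I B)) (λ { refl → ≢₁ }))
                 (λ { refl → _ , _ , e₀ }))
      , (λ b → relax (≤ᵇ⇒≤ 24 32 _) (one-step e₀ (red-run _ (_ , _ , e₀) A b) (λ { refl → _ , _ , e₀ })))
      ]′ (redRule P e₁ .proj₁)

-- Paths as edge sequences, split at their newest edge

Unique-++⁻ : ∀ (js : List ℕ) {ks} → Unique (js ++ ks) → Unique js × Unique ks × (∀ {j} → j ∈ js → j ∉ ks)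
Unique-++⁻ [] U = [] , U , λ ()
Unique-++⁻ (i ∷ js) (i≢ ∷ U) with Unique-++⁻ js U
... | V , W , D = All-++⁻ˡ js i≢ ∷ V , W ,
  λ { (here refl) j∈ → All.lookup i≢ (∈-++⁺ʳ js j∈) refl ; (there j∈) → D j∈ }

data Trail {a r} (E : Board a r) (c : Fin r) : Fin a → List ℕ → Fin a → Set where
  []  : ∀ {x} → Trail E c x [] x
  _∷_ : ∀ {x y z i js} → Edge E i x y c → Trail E c y js z → Trail E c x (i ∷ js) z

module _ {a r : ℕ} {E : Board a r} where

  monoPath⇒trail : ∀ {c} n (f : Fin (suc n) → Fin a) → (∀ {i j} → f i ≡ f j → i ≡ j) →
                   (∀ i → HasEdge E c (f (inject₁ i)) (f (suc i))) →
                   ∃[ js ] ∃[ y ] Trail E c (f zero) js y × length js ≡ n × Unique js ×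
                           All (λ i → ∃[ j ] (Edge E i (f (inject₁ j)) (f (suc j)) c)) js
  monoPath⇒trail zero f inj h = [] , _ , [] , refl , [] , []
  monoPath⇒trail (suc n) f inj h
    with hasEdge⇒edge (h zero) | monoPath⇒trail n (f ∘ suc) (λ eq → Fin-suc-injective (inj eq)) (h ∘ suc)
  ... | i , e | js , y , T , len , U , A =
    i ∷ js , y , e ∷ T , cong suc len , All.map fresh A ∷ U , (zero , e) ∷ All.map (λ (j , g) → suc j , g) A
    where
    fresh : ∀ {i′} → ∃[ j ] Edge E i′ (f (suc (inject₁ j))) (f (suc (suc j))) _ → i ≢ i′
    fresh (j , g) refl with edge-unique e g
    ... | _ , inj₁ (eq , _) with () ← inj eq
    ... | _ , inj₂ (eq , _) with () ← inj eq

  trail⇒arm : ∀ {c t f x js y} → Trail E c x js y → Unique js → All (_< t) js → f ∉ js → Arm E c t f x (length js)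
  trail⇒arm [] _ _ _ = end
  trail⇒arm (e ∷ T) (i≢ ∷ U) (i< ∷ L) f∉ =
    step e i< (λ { refl → f∉ (here refl) }) (trail⇒arm T U L (λ i∈ → All.lookup i≢ i∈ refl))

  -- Reversal with an accumulator: `k` continues the arm beyond `x`, after whichever edge the
  -- reversed trail arrives by, or after `t` if the trail is empty.
  trail⇒arm⁻ : ∀ {c t x js y n} → Trail E c x js y → Unique js → All (_< t) js →
               (∀ {f} → f ∈ js ⊎ f ≡ t → Arm E c t f x n) → Arm E c t t y (length js + n)
  trail⇒arm⁻ [] _ _ k = k (inj₂ refl)
  trail⇒arm⁻ {c} {t} {n = n} (_∷_ {y = y} {i = i} {js} e T) (i≢ ∷ U) (i< ∷ L) k =
    subst (Arm E _ _ _ _) (+-suc (length js) n) (trail⇒arm⁻ T U L k′)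
    where
    k′ : ∀ {f} → f ∈ js ⊎ f ≡ t → Arm E c t f y (suc n)
    k′ (inj₁ f∈)   = step (edge-sym e) i< (All.lookup i≢ f∈) (k (inj₁ (here refl)))
    k′ (inj₂ refl) = step (edge-sym e) i< (<⇒≢ i<) (k (inj₁ (here refl)))

  -- When the newest edge was presented, the rest of the path was already there, so Painter's rule
  -- for that edge applies to the two pieces.
  record Newest (c : Fin r) (x : Fin a) (js : List ℕ) (y : Fin a) : Set where
    field
      {u v}     : Fin a
      before    : List ℕ
      newest    : ℕ
      after     : List ℕ
      split     : js ≡ before ++ newest ∷ after
      trail₁    : Trail E c x before u
      edge      : Edge E newest u v c
      trail₂    : Trail E c v after y
      older₁    : All (_< newest) before
      older₂    : All (_< newest) after

  find-newest : ∀ {c x i js y} → Trail E c x (i ∷ js) y → Unique (i ∷ js) → Newest c x (i ∷ js) y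
  find-newest (e ∷ []) _ = record { split = refl ; trail₁ = [] ; edge = e ; trail₂ = [] ; older₁ = [] ; older₂ = [] }
  find-newest {i = i} (e ∷ T@(_ ∷ _)) (i≢ ∷ U) with find-newest T U
  ... | N with <-cmp i (Newest.newest N)
  ...   | tri< i<j _ _ = record
    { split = cong (i ∷_) (Newest.split N) ; trail₁ = e ∷ Newest.trail₁ N ; edge = Newest.edge N
    ; trail₂ = Newest.trail₂ N ; older₁ = i<j ∷ Newest.older₁ N ; older₂ = Newest.older₂ N }
  ...   | tri≈ _ i≡j _ =
    ⊥-elim (All.lookup i≢ (subst (Newest.newest N ∈_) (sym (Newest.split N)) (∈-++⁺ʳ (Newest.before N) (here refl))) i≡j)
  ...   | tri> _ _ j<i = record
    { split = refl ; trail₁ = [] ; edge = e ; trail₂ = T ; older₁ = []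
    ; older₂ = subst (All (_< i)) (sym (Newest.split N))
                 (All-++⁺ (All.map (λ p → <-trans p j<i) (Newest.older₁ N))
                          (j<i ∷ All.map (λ p → <-trans p j<i) (Newest.older₂ N))) }

  newest-arms : ∀ {c x i js y} → Unique (i ∷ js) → (N : Newest c x (i ∷ js) y) →
                Arms E c (Newest.newest N) (Newest.u N) (Newest.v N) (length js)
  newest-arms {js = js} U
    record { before = js₁ ; newest = j ; after = js₂ ; split = eq
           ; trail₁ = T₁ ; trail₂ = T₂ ; older₁ = L₁ ; older₂ = L₂ }
    with Unique-++⁻ js₁ (subst Unique eq U)
  ... | U₁ , j≢ ∷ U₂ , _ =
    length js₁ , length js₂ , suc-injective len ,
    subst (Arm E _ _ _ _) (+-identityʳ _) (trail⇒arm⁻ T₁ U₁ L₁ (λ _ → end)) ,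
    trail⇒arm T₂ U₂ L₂ (λ j∈ → All.lookup j≢ j∈ refl)
    where
    len : suc (length js₁ + length js₂) ≡ suc (length js)
    len = trans (sym (+-suc (length js₁) _)) (trans (sym (length-++ js₁)) (cong length (sym eq)))

  trail-coloured : ∀ {c x js y} → Trail E c x js y → ∀ {k} → k ∈ js → Coloured E c k
  trail-coloured (e ∷ T) (here refl) = _ , _ , e
  trail-coloured (e ∷ T) (there k∈)  = trail-coloured T k∈

  prepend : ∀ {c Q x js y n} → Trail E c x js y → Unique js → (∀ {k} → k ∈ js → ¬ Q k) →
            Tree E Q y n → Tree E (λ k → k ∈ js ⊎ Q k) x (length js + n)
  prepend [] _ _ t = tree-map inj₂ t
  prepend {Q = Q} (_∷_ {i = i} {js} e T) (i≢ ∷ U) ¬Q t =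
    tree-map (λ { refl → inj₁ (here refl) }) (extend e (tree-map avoid (prepend T U (¬Q ∘ there) t)))
    where
    avoid : ∀ {k} → k ∈ js ⊎ Q k → k ≢ i
    avoid (inj₁ k∈) refl = All.lookup i≢ k∈ refl
    avoid (inj₂ q)  refl = ¬Q (here refl) q

module _ {a m : ℕ} {E : Board a 2} (P : Painted m E) where
  open Painted P

  -- The second half of `RedRule` for the newest edge forbids exactly the two pieces beside it.
  no-red-path : ∀ {x js y} → Trail E red x js y → Unique js → length js ≢ suc m
  no-red-path (e ∷ T) U refl =
    proj₂ (redRule (Newest.edge N)) (newest-arms U N)
    where N = find-newest (e ∷ T) U

  -- The newest of four consecutive blue edges closes a blue P₄, so it carries red arms of total length m.
  block : ∀ {x i js y l z n} → Trail E blue x (i ∷ js) y → Unique (i ∷ js) → length js ≡ 3 →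
          l ∉ i ∷ js → Edge E l y z blue → Tree E (_≢ l) z n →
          ∃[ k ] 8 * m + 3 * n ≤ 3 * k + 64 × Tree E (λ j → Red P j ⊎ j ∈ i ∷ js) x k
  block {i = i} {js} {l = l} {n = n} T U len l∉ f t with find-newest T U
  ... | N with proj₂ (blueRule (Newest.edge N))
  ...   | inj₁ ¬b = ⊥-elim (¬b (subst (Arms E blue _ _ _) len (newest-arms U N)))
  block {i = i} {js} {l = l} {n = n} T U len l∉ f t
      | record { before = js₁ ; newest = j ; after = js₂ ; split = eq ; trail₁ = T₁ ; edge = e ; trail₂ = T₂ }
        | inj₂ (m₁ , m₂ , m≡ , A , B)
    with Unique-++⁻ js₁ (subst Unique eq U) | red-arm P A | red-arm P B
  ... | U₁ , j≢ ∷ U₂ , D | costly k₁ b₁ t₁ | costly k₂ b₂ t₂ = _ , bound , tree-map final tree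
    where
    ∈split : ∀ {k} → k ∈ js₁ ++ j ∷ js₂ → k ∈ i ∷ js
    ∈split = subst (_ ∈_) (sym eq)
    tail : Tree E (λ k → k ∈ js₂ ⊎ k ≡ l) _ (length js₂ + suc n)
    tail = prepend T₂ U₂ (λ { k∈ refl → l∉ (∈split (∈-++⁺ʳ js₁ (there k∈))) }) (extend f t)
    tail-blue : ∀ {k} → k ∈ js₂ ⊎ k ≡ l → Blue P k
    tail-blue (inj₁ k∈)   = trail-coloured T₂ k∈
    tail-blue (inj₂ refl) = _ , _ , f
    avoid : ∀ {k} → (k ∈ js₂ ⊎ k ≡ l) ⊎ Red P k → k ≢ j
    avoid (inj₁ (inj₁ k∈))   refl = All.lookup j≢ k∈ refl
    avoid (inj₁ (inj₂ refl)) refl = l∉ (∈split (∈-++⁺ʳ js₁ (here refl)))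
    avoid (inj₂ r)           refl = red≢blue P r (_ , _ , e) refl
    middle : Tree E (λ k → k ≡ j ⊎ Red P k) _ (suc (length js₂ + suc n + k₂) + k₁)
    middle = merge (λ { refl r → red≢blue P r (_ , _ , e) refl })
               (extend e (tree-map avoid (merge (λ q r → red≢blue P r (tail-blue q) refl) tail t₂))) t₁
    fresh : ∀ {k} → k ∈ js₁ → ¬ (k ≡ j ⊎ Red P k)
    fresh k∈ (inj₁ refl) = D k∈ (here refl)
    fresh k∈ (inj₂ r)    = red≢blue P r (trail-coloured T₁ k∈) refl
    tree : Tree E (λ k → k ∈ js₁ ⊎ (k ≡ j ⊎ Red P k)) _ (length js₁ + (suc (length js₂ + suc n + k₂) + k₁))
    tree = prepend T₁ U₁ fresh middle
    final : ∀ {k} → k ∈ js₁ ⊎ (k ≡ j ⊎ Red P k) → Red P k ⊎ k ∈ i ∷ js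
    final (inj₁ k∈)          = inj₂ (∈split (∈-++⁺ˡ k∈))
    final (inj₂ (inj₁ refl)) = inj₂ (∈split (∈-++⁺ʳ js₁ (here refl)))
    final (inj₂ (inj₂ r))    = inj₁ r
    open ≤-Reasoning
    regroup : ∀ k₁ k₂ n p q → 3 * k₁ + 32 + (3 * k₂ + 32) + 3 * n + 3 * (p + q + 2) ≡
                              3 * (p + (suc (q + suc n + k₂) + k₁)) + 64
    regroup = solve-∀
    bound : 8 * m + 3 * n ≤ 3 * (length js₁ + (suc (length js₂ + suc n + k₂) + k₁)) + 64
    bound = begin
      8 * m + 3 * n                              ≡⟨ cong (λ x → 8 * x + 3 * n) (sym m≡) ⟩
      8 * (m₁ + m₂) + 3 * n                      ≡⟨ cong (_+ 3 * n) (*-distribˡ-+ 8 m₁ m₂) ⟩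
      8 * m₁ + 8 * m₂ + 3 * n                    ≤⟨ +-monoˡ-≤ (3 * n) (+-mono-≤ b₁ b₂) ⟩
      -- The blue edges added here contribute only a lower-order term to the total and are dropped.
      3 * k₁ + 32 + (3 * k₂ + 32) + 3 * n        ≤⟨ m≤m+n _ _ ⟩
      3 * k₁ + 32 + (3 * k₂ + 32) + 3 * n + 3 * (length js₁ + length js₂ + 2)
                                                 ≡⟨ regroup k₁ k₂ n (length js₁) (length js₂) ⟩
      3 * (length js₁ + (suc (length js₂ + suc n + k₂) + k₁)) + 64 ∎

  -- Every fifth edge is a spacer: without it neighbouring blocks would share a vertex, and both
  -- might claim the same red arm there.
  blue-path-cost : ∀ N {x js y} → Trail E blue x js y → Unique js → N * 5 ≤ length js →
              ∃[ k ] N * (8 * m) ≤ 3 * k + N * 64 × Tree E (λ j → Red P j ⊎ j ∈ js) x k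
  blue-path-cost zero T U _ = 0 , z≤n , bare
  blue-path-cost (suc N) {js = i₁ ∷ i₂ ∷ i₃ ∷ i₄ ∷ l ∷ js}
      (e₁ ∷ e₂ ∷ e₃ ∷ e₄ ∷ f ∷ T) U (s≤s (s≤s (s≤s (s≤s (s≤s len)))))
    with Unique-++⁻ (i₁ ∷ i₂ ∷ i₃ ∷ i₄ ∷ []) U
  ... | U₄ , l≢ ∷ U′ , D with blue-path-cost N T U′ len
  ...   | n , le , t with block (e₁ ∷ e₂ ∷ e₃ ∷ e₄ ∷ []) U₄ refl (λ l∈ → D l∈ (here refl)) f (tree-map avoid t)
    where
    avoid : ∀ {k} → Red P k ⊎ k ∈ js → k ≢ l
    avoid (inj₁ r)  = red≢blue P r (_ , _ , f)
    avoid (inj₂ k∈) refl = All.lookup l≢ k∈ refl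
  ...     | k , le′ , t′ = k , bound , tree-map (λ { (inj₁ r) → inj₁ r ; (inj₂ k∈) → inj₂ (∈-++⁺ˡ k∈) }) t′
    where
    open ≤-Reasoning
    regroup : ∀ k p → 3 * k + 64 + p ≡ 3 * k + (64 + p)
    regroup = solve-∀
    bound : suc N * (8 * m) ≤ 3 * k + suc N * 64
    bound = begin
      8 * m + N * (8 * m)          ≤⟨ +-monoʳ-≤ (8 * m) le ⟩
      8 * m + (3 * n + N * 64)     ≡⟨ sym (+-assoc (8 * m) (3 * n) (N * 64)) ⟩
      8 * m + 3 * n + N * 64       ≤⟨ +-monoˡ-≤ (N * 64) le′ ⟩
      3 * k + 64 + N * 64          ≡⟨ regroup k (N * 64) ⟩
      3 * k + (64 + N * 64)        ∎

  painter-bound : ∀ {k} → ComponentsAtMost k E → MonoPath (suc m) E → ∀ N → N * 5 ≤ suc m →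
                  N * (8 * m) ≤ 3 * k + N * 64
  painter-bound {k} K (c , f , inj , h) N N≤ with monoPath⇒trail (suc m) f inj h
  painter-bound {k} K (red , f , inj , h) N N≤ | js , _ , T , len , U , _ = ⊥-elim (no-red-path T U len)
  painter-bound {k} K (blue , f , inj , h) N N≤ | js , _ , T , len , U , _
    with blue-path-cost N T U (subst (N * 5 ≤_) (sym len) N≤)
  ... | n , le , (_ , t , _) = ≤-trans le (+-monoˡ-≤ (N * 64) (*-monoʳ-≤ 3 (branching-≤ forest K t)))

-- From the cost of a blue path to the constant 8/15

module _ {a : ℕ} where

  -- Induction on Builder's strategy, following an answer that keeps the board `Painted`; at a leaf
  -- the finished path contradicts the cost bound.
  play : ∀ {m k} N {E : Board a 2} → N * 5 ≤ suc (suc m) → ¬ (N * (8 * suc m) ≤ 3 * k + N * 64) →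
         Painted (suc m) E → ComponentsAtMost k E → ¬ BuilderWinsFrom (suc (suc m)) k 2 E
  play N N≤ ¬le P K (painterLost M) = ¬le (painter-bound P K M N N≤)
  play N N≤ ¬le P K (present u v ¬uv comps next) =
    painter-move P ¬uv (λ P′ → play N N≤ ¬le P′ (comps red) (next red)) (λ P′ → play N N≤ ¬le P′ (comps blue) (next blue))

builder-needs : ∀ {m k} → BuilderWins (suc (suc m)) k 2 → ∀ N → N * 5 ≤ suc (suc m) →
                N * (8 * suc m) ≤ 3 * k + N * 64
builder-needs {m} {k} (a , W) N N≤ =
  decidable-stable (N * (8 * suc m) ≤? 3 * k + N * 64) (λ ¬le → play N N≤ ¬le painted-[] comps W)
  where
  comps : ComponentsAtMost k []
  comps w [] _ _ = z≤n

quadratic : ∀ {ℓ k} → 2 ≤ ℓ → BuilderWins ℓ k 2 → 8 * (ℓ * ℓ) ≤ 15 * k + 104 * ℓ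
quadratic {suc (suc m)} {k} (s≤s (s≤s z≤n)) W = begin
  8 * (ℓ * ℓ)                                  ≡⟨ e₀ ℓ ⟩
  -- Of the 104, 32 is for the up to four edges lost in rounding `ℓ / 5`; 72 collects the 64 lost
  -- per block and the arms having total length `ℓ` minus one.
  8 * ℓ * ℓ                                    ≤⟨ *-monoʳ-≤ (8 * ℓ) ℓ≤ ⟩
  8 * ℓ * (4 + N * 5)                          ≡⟨ e₁ N m ⟩
  5 * (N * (8 * suc m)) + (8 * (N * 5) + 32 * ℓ)    ≤⟨ +-monoˡ-≤ _ (*-monoʳ-≤ 5 (builder-needs W N N≤)) ⟩
  5 * (3 * k + N * 64) + (8 * (N * 5) + 32 * ℓ)     ≡⟨ e₂ k N ℓ ⟩
  15 * k + (72 * (N * 5) + 32 * ℓ)             ≤⟨ +-monoʳ-≤ (15 * k) (+-monoˡ-≤ (32 * ℓ) (*-monoʳ-≤ 72 N≤)) ⟩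
  15 * k + (72 * ℓ + 32 * ℓ)                   ≡⟨ cong (15 * k +_) (sym (*-distribʳ-+ ℓ 72 32)) ⟩
  15 * k + 104 * ℓ                             ∎
  where
  open ≤-Reasoning
  ℓ = suc (suc m)
  N = ℓ / 5
  N≤ : N * 5 ≤ ℓ
  N≤ = m/n*n≤m ℓ 5
  ℓ≤ : ℓ ≤ 4 + N * 5
  ℓ≤ = subst (_≤ 4 + N * 5) (sym (m≡m%n+[m/n]*n ℓ 5)) (+-monoˡ-≤ (N * 5) (s≤s⁻¹ (m%n<n ℓ 5)))
  e₀ : ∀ ℓ → 8 * (ℓ * ℓ) ≡ 8 * ℓ * ℓ
  e₀ = solve-∀
  e₁ : ∀ N m → 8 * suc (suc m) * (4 + N * 5) ≡ 5 * (N * (8 * suc m)) + (8 * (N * 5) + 32 * suc (suc m))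
  e₁ = solve-∀
  e₂ : ∀ k N ℓ → 5 * (3 * k + N * 64) + (8 * (N * 5) + 32 * ℓ) ≡ 15 * k + (72 * (N * 5) + 32 * ℓ)
  e₂ = solve-∀

lower-bound : ∀ (p q : ℕ) → 15 * p < 8 * suc q →
              ∃[ L ] ∀ (ℓ k : ℕ) → L ≤ ℓ → BuilderWins ℓ k 2 → p * (ℓ ^ 2) ≤ suc q * k
-- The strict inequality leaves a surplus of `ℓ * ℓ`, which from this threshold on outweighs
-- `104 * suc q * ℓ`.
lower-bound p q p<q = 104 * suc q , bound
  where
  open ≤-Reasoning
  bound : ∀ (ℓ k : ℕ) → 104 * suc q ≤ ℓ → BuilderWins ℓ k 2 → p * (ℓ ^ 2) ≤ suc q * k
  bound ℓ k L≤ℓ W = *-cancelˡ-≤ 15 (+-cancelʳ-≤ (ℓ * ℓ) _ _ (begin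
    15 * (p * (ℓ ^ 2)) + ℓ * ℓ                 ≡⟨ e₁ p ℓ ⟩
    suc (15 * p) * (ℓ * ℓ)                     ≤⟨ *-monoˡ-≤ (ℓ * ℓ) p<q ⟩
    8 * suc q * (ℓ * ℓ)                        ≡⟨ e₂ q ℓ ⟩
    suc q * (8 * (ℓ * ℓ))                      ≤⟨ *-monoʳ-≤ (suc q) (quadratic 2≤ℓ W) ⟩
    suc q * (15 * k + 104 * ℓ)                 ≡⟨ e₃ q k ℓ ⟩
    15 * (suc q * k) + 104 * suc q * ℓ         ≤⟨ +-monoʳ-≤ (15 * (suc q * k)) (*-monoˡ-≤ ℓ L≤ℓ) ⟩
    15 * (suc q * k) + ℓ * ℓ                   ∎))
    where
    2≤ℓ : 2 ≤ ℓ
    2≤ℓ = ≤-trans (≤ᵇ⇒≤ 2 104 _) (≤-trans (m≤m*n 104 (suc q)) L≤ℓ)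
    e₁ : ∀ p ℓ → 15 * (p * (ℓ * (ℓ * 1))) + ℓ * ℓ ≡ suc (15 * p) * (ℓ * ℓ)
    e₁ = solve-∀
    e₂ : ∀ q ℓ → 8 * suc q * (ℓ * ℓ) ≡ suc q * (8 * (ℓ * ℓ))
    e₂ = solve-∀
    e₃ : ∀ q k ℓ → suc q * (15 * k + 104 * ℓ) ≡ 15 * (suc q * k) + 104 * suc q * ℓ
    e₃ = solve-∀

-- Builder's strategy

module _ {a r : ℕ} where

  reach-trans : ∀ {E : Board a r} {x y z} → Reach E x y → Reach E y z → Reach E x z
  reach-trans p q = walk⇒reach (walk-trans (reach⇒walk p) (reach⇒walk q))

  reach-old : ∀ {E : Board a r} {e x y} → Reach E x y → Reach (e ∷ E) x y
  reach-old here                     = here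
  reach-old (step (c , inj₁ p) w) = step (c , inj₁ (there p)) (reach-old w)
  reach-old (step (c , inj₂ p) w) = step (c , inj₂ (there p)) (reach-old w)

  reach-older : ∀ {E : Board a r} {u v c x y} → Reach ((u , v , c) ∷ E) x y →
                Reach E x y ⊎ (Reach E x u × Reach E v y) ⊎ (Reach E x v × Reach E u y)
  reach-older w with walk-older (reach⇒walk w)
  ... | inj₁ q               = inj₁ (walk⇒reach q)
  ... | inj₂ (inj₁ (p , q)) = inj₂ (inj₁ (walk⇒reach p , walk⇒reach q))
  ... | inj₂ (inj₂ (p , q)) = inj₂ (inj₂ (walk⇒reach p , walk⇒reach q))

  Away : Board a r → Fin a → Fin a → Fin a → Set
  Away E u v x = ¬ Reach E u x × ¬ Reach E v x

  away-reach : ∀ {E : Board a r} {u v c x y} → Away E u v x → Reach ((u , v , c) ∷ E) x y → Reach E x y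
  away-reach (¬u , ¬v) w with reach-older w
  ... | inj₁ q              = q
  ... | inj₂ (inj₁ (p , _)) = ⊥-elim (¬u (reach-sym p))
  ... | inj₂ (inj₂ (p , _)) = ⊥-elim (¬v (reach-sym p))

  away-new : ∀ {E : Board a r} {u v c x} → Away E u v x → ¬ Reach ((u , v , c) ∷ E) u x
  away-new A@(¬u , ¬v) w = ¬u (reach-sym (away-reach A (reach-sym w)))

  SizeAtMost : Board a r → Fin a → ℕ → Set
  SizeAtMost E x n = ∀ (L : List (Fin (length E))) → Unique L →
                     All (λ i → Reach E x (proj₁ (lookup E i))) L → length L ≤ n

  OfSuc : ∀ {m} → (Fin m → Set) → Fin (suc m) → Set
  OfSuc A zero    = ⊤
  OfSuc A (suc j) = A j

  -- Position `zero` is the new edge and older positions are shifted by one. Without duplicates the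
  -- new edge occurs at most once, whence the single `suc` in the last bound.
  partition-suc : ∀ {m} {A B : Fin m → Set} (L : List (Fin (suc m))) → Unique L →
                  All (OfSuc (λ j → A j ⊎ B j)) L →
                  ∃₂ λ M N → (Unique M × All (λ j → suc j ∈ L) M × All A M) ×
                             (Unique N × All (λ j → suc j ∈ L) N × All B N) ×
                             (zero ∉ L → length L ≤ length M + length N) ×
                             length L ≤ suc (length M + length N)
  partition-suc [] _ _ = [] , [] , ([] , [] , []) , ([] , [] , []) , (λ _ → z≤n) , z≤n
  partition-suc (i ∷ L) (i≢ ∷ U) (a ∷ as) with partition-suc L U as
  partition-suc (zero ∷ L) (i≢ ∷ U) (a ∷ as) | M , N , (U₁ , ∈₁ , A₁) , (U₂ , ∈₂ , B₂) , le , _ =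
    M , N , (U₁ , All.map there ∈₁ , A₁) , (U₂ , All.map there ∈₂ , B₂) ,
    (λ 0∉ → ⊥-elim (0∉ (here refl))) , s≤s (le (λ 0∈ → All.lookup i≢ 0∈ refl))
  partition-suc (suc j ∷ L) (i≢ ∷ U) (inj₁ a ∷ as) | M , N , (U₁ , ∈₁ , A₁) , (U₂ , ∈₂ , B₂) , le , le′ =
    j ∷ M , N , (All.map (λ k∈ → λ { refl → All.lookup i≢ k∈ refl }) ∈₁ ∷ U₁ , here refl ∷ All.map there ∈₁ , a ∷ A₁) ,
    (U₂ , All.map there ∈₂ , B₂) , (λ 0∉ → s≤s (le (0∉ ∘ there))) , s≤s le′
  partition-suc (suc j ∷ L) (i≢ ∷ U) (inj₂ b ∷ as) | M , N , (U₁ , ∈₁ , A₁) , (U₂ , ∈₂ , B₂) , le , le′ =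
    M , j ∷ N , (U₁ , All.map there ∈₁ , A₁) ,
    (All.map (λ k∈ → λ { refl → All.lookup i≢ k∈ refl }) ∈₂ ∷ U₂ , here refl ∷ All.map there ∈₂ , b ∷ B₂) ,
    (λ 0∉ → ≤-trans (s≤s (le (0∉ ∘ there))) (≤-reflexive (sym (+-suc (length M) (length N))))) ,
    ≤-trans (s≤s le′) (s≤s (≤-reflexive (sym (+-suc (length M) (length N)))))

  size-join : ∀ {E : Board a r} {u v c x m n} → SizeAtMost E u m → SizeAtMost E v n → Reach E x u ⊎ Reach E x v →
              SizeAtMost ((u , v , c) ∷ E) x (suc (m + n))
  size-join {E} {u} {v} {c} {x} Su Sv x~ L U R with partition-suc L U (All.map (λ {i} → sides i) R)
    where
    sides : ∀ i → Reach ((u , v , c) ∷ E) x (proj₁ (lookup ((u , v , c) ∷ E) i)) →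
            OfSuc (λ j → Reach E u (proj₁ (lookup E j)) ⊎ Reach E v (proj₁ (lookup E j))) i
    sides zero    _ = tt
    sides (suc j) w with reach-older w
    ... | inj₁ q = [ (λ p → inj₁ (reach-trans (reach-sym p) q)) , (λ p → inj₂ (reach-trans (reach-sym p) q)) ]′ x~
    ... | inj₂ (inj₁ (_ , q)) = inj₂ q
    ... | inj₂ (inj₂ (_ , q)) = inj₁ q
  ... | M , N , (U₁ , _ , A₁) , (U₂ , _ , B₂) , _ , le = ≤-trans le (s≤s (+-mono-≤ (Su M U₁ A₁) (Sv N U₂ B₂)))

  size-away : ∀ {E : Board a r} {u v c x n} → Away E u v x → SizeAtMost E x n → SizeAtMost ((u , v , c) ∷ E) x n
  size-away {E} {u} {v} {c} {x} A S L U R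
    with partition-suc {B = λ _ → ⊥} L U (All.map (λ {i} → sides i) R)
    where
    sides : ∀ i → Reach ((u , v , c) ∷ E) x (proj₁ (lookup ((u , v , c) ∷ E) i)) →
            OfSuc (λ j → Reach E x (proj₁ (lookup E j)) ⊎ ⊥) i
    sides zero    _ = tt
    sides (suc j) w = inj₁ (away-reach A w)
  ... | M , [] , (U₁ , _ , A₁) , _ , le , _ =
    ≤-trans (le (λ 0∈ → proj₁ A (reach-sym (away-reach A (All.lookup R 0∈)))))
            (≤-trans (≤-reflexive (+-identityʳ (length M))) (S M U₁ A₁))
  ... | M , (_ ∷ _) , _ , (_ , _ , () ∷ _) , _ , _

  components-∷ : ∀ {E : Board a r} {u v c m n k} → SizeAtMost E u m → SizeAtMost E v n → suc (m + n) ≤ k →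
                 ComponentsAtMost k E → ComponentsAtMost k ((u , v , c) ∷ E)
  components-∷ {E} {u} {v} {k = k} Su Sv ≤k K w L U R =
    -- Whether `w` lies in the joined component is not decided, but the bound to be shown is.
    decidable-stable (length L ≤? k) λ ¬le →
    ¬¬em {A = Reach E w u} λ p → ¬¬em {A = Reach E w v} λ q → ¬le (cases p q)
    where
    cases : Reach E w u ⊎ ¬ Reach E w u → Reach E w v ⊎ ¬ Reach E w v → length L ≤ k
    cases (inj₁ p) _ = ≤-trans (size-join Su Sv (inj₁ p) L U R) ≤k
    cases (inj₂ _) (inj₁ q) = ≤-trans (size-join Su Sv (inj₂ q) L U R) ≤k
    cases (inj₂ p) (inj₂ q) = size-away (p ∘ reach-sym , q ∘ reach-sym) (K w) L U R

  data Chain (E : Board a r) (c : Fin r) : Fin a → List (Fin a) → Set where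
    []  : ∀ {x} → Chain E c x []
    _∷_ : ∀ {x y ys} → HasEdge E c x y → Chain E c y ys → Chain E c x (y ∷ ys)

  PathFrom : Board a r → Fin r → ℕ → Fin a → Set
  PathFrom E c s x = ∃[ ys ] Chain E c x ys × Unique (x ∷ ys) × s ≤ length ys

  hasEdge-old : ∀ {E : Board a r} {e c x y} → HasEdge E c x y → HasEdge (e ∷ E) c x y
  hasEdge-old (inj₁ p) = inj₁ (there p)
  hasEdge-old (inj₂ p) = inj₂ (there p)

  chain-old : ∀ {E : Board a r} {e c x ys} → Chain E c x ys → Chain (e ∷ E) c x ys
  chain-old []      = []
  chain-old (h ∷ C) = hasEdge-old h ∷ chain-old C

  path-old : ∀ {E : Board a r} {e c s x} → PathFrom E c s x → PathFrom (e ∷ E) c s x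
  path-old (ys , C , U , le) = ys , chain-old C , U , le

  path-zero : ∀ {E : Board a r} {c x} → PathFrom E c 0 x
  path-zero = [] , [] , [] ∷ [] , z≤n

  chain-reach : ∀ {E : Board a r} {c x ys} → Chain E c x ys → All (Reach E x) (x ∷ ys)
  chain-reach []      = here ∷ []
  chain-reach (h ∷ C) = here ∷ All.map (step (_ , h)) (chain-reach C)

  chain-unreachable : ∀ {E : Board a r} {c u v ys} → ¬ Reach E u v → Chain E c v ys → All (u ≢_) (v ∷ ys)
  chain-unreachable ¬uv C = All.map (λ { w refl → ¬uv (reach-sym w) }) (chain-reach C)

  path-cons : ∀ {E : Board a r} {e c s u v} → ¬ Reach E u v → HasEdge (e ∷ E) c u v →
              PathFrom E c s v → PathFrom (e ∷ E) c (suc s) u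
  path-cons ¬uv h (ys , C , U , le) = _ ∷ ys , h ∷ chain-old C , chain-unreachable ¬uv C ∷ U , s≤s le

  hasEdge-sym : ∀ {E : Board a r} {c x y} → HasEdge E c x y → HasEdge E c y x
  hasEdge-sym (inj₁ p) = inj₂ p
  hasEdge-sym (inj₂ p) = inj₁ p

  chain-ʳ++ : ∀ {E : Board a r} {c x xs y ys} → Chain E c x xs → HasEdge E c x y → Chain E c y ys →
              ∃₂ λ w ws → Chain E c w ws × w ∷ ws ≡ (x ∷ xs) ʳ++ (y ∷ ys) × Reach E x w
  chain-ʳ++ [] h D = _ , _ , h ∷ D , refl , here
  chain-ʳ++ (g ∷ C) h D with chain-ʳ++ C (hasEdge-sym g) (h ∷ D)
  ... | w , ws , W , eq , r = w , ws , W , eq , step (_ , g) r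

  Unique-ʳ++ : ∀ {xs ys : List (Fin a)} → Unique xs → Unique ys → All (λ x → All (x ≢_) ys) xs → Unique (xs ʳ++ ys)
  Unique-ʳ++ [] V _ = V
  Unique-ʳ++ (x≢ ∷ U) V (p ∷ ps) =
    Unique-ʳ++ U (p ∷ V) (All.zipWith (λ (q , qs) → (q ∘ sym) ∷ qs) (x≢ , ps))

  -- The first path is reversed, so the joined one starts at its far end `w`, still inside the new
  -- component.
  path-join : ∀ {E : Board a r} {c s u v} → ¬ Reach E u v → PathFrom E c s u → PathFrom E c s v →
              ∃[ w ] PathFrom ((u , v , c) ∷ E) c (suc (s + s)) w × Reach ((u , v , c) ∷ E) u w
  path-join {s = s} {u} {v} ¬uv (xs , C , U , le) (ys , D , V , le′) with chain-ʳ++ (chain-old C) (inj₁ (here refl)) (chain-old D)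
  ... | w , ws , W , eq , r = w , (ws , W , subst Unique (sym eq) UV , len) , r
    where
    UV : Unique ((u ∷ xs) ʳ++ (v ∷ ys))
    UV = Unique-ʳ++ U V (All.map (λ {x} ux → chain-unreachable (λ xv → ¬uv (reach-trans ux xv)) D) (chain-reach C))
    eqlen : length ws ≡ suc (length xs + length ys)
    eqlen = suc-injective (trans (cong length eq)
              (trans (length-ʳ++ (u ∷ xs)) (cong suc (+-suc (length xs) (length ys)))))
    len : suc (s + s) ≤ length ws
    len = subst (suc (s + s) ≤_) (sym eqlen) (s≤s (+-mono-≤ le le′))

  vertexAt : ∀ {ℓ} (x : Fin a) (ys : List (Fin a)) → ℓ ≤ length ys → Fin (suc ℓ) → Fin a
  vertexAt x ys       le       zero    = x
  vertexAt x (y ∷ ys) (s≤s le) (suc i) = vertexAt y ys le i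

  vertexAt-∈ : ∀ {ℓ} x ys (le : ℓ ≤ length ys) i → vertexAt x ys le i ∈ x ∷ ys
  vertexAt-∈ x ys       le       zero    = here refl
  vertexAt-∈ x (y ∷ ys) (s≤s le) (suc i) = there (vertexAt-∈ y ys le i)

  vertexAt-injective : ∀ {ℓ} {x ys} (le : ℓ ≤ length ys) → Unique (x ∷ ys) → ∀ {i j} →
                       vertexAt x ys le i ≡ vertexAt x ys le j → i ≡ j
  vertexAt-injective le U {zero} {zero} _ = refl
  vertexAt-injective {ys = y ∷ ys} (s≤s le) (x≢ ∷ U) {zero} {suc j} eq = ⊥-elim (All.lookup x≢ (vertexAt-∈ y ys le j) eq)
  vertexAt-injective {ys = y ∷ ys} (s≤s le) (x≢ ∷ U) {suc i} {zero} eq = ⊥-elim (All.lookup x≢ (vertexAt-∈ y ys le i) (sym eq))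
  vertexAt-injective {ys = y ∷ ys} (s≤s le) (x≢ ∷ U) {suc i} {suc j} eq = cong suc (vertexAt-injective le U eq)

  vertexAt-edge : ∀ {ℓ} {E : Board a r} {c x ys} (le : ℓ ≤ length ys) → Chain E c x ys →
                  ∀ i → HasEdge E c (vertexAt x ys le (inject₁ i)) (vertexAt x ys le (suc i))
  vertexAt-edge (s≤s le) (h ∷ C) zero    = h
  vertexAt-edge (s≤s le) (h ∷ C) (suc i) = vertexAt-edge le C i

  path⇒monoPath : ∀ {E : Board a r} {c s ℓ x} → ℓ ≤ s → PathFrom E c s x → MonoPath ℓ E
  path⇒monoPath {c = c} ℓ≤ (ys , C , U , le) =
    c , vertexAt _ ys (≤-trans ℓ≤ le) , vertexAt-injective _ U , vertexAt-edge _ C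

-- Pools of components and rounds of joining

stock : ℕ → ℕ → ℕ
stock M zero    = M
-- A round uses up two of each kind; the explicit constructors let `replicate` unfold that far.
stock M (suc g) = suc (suc (stock M g))

stock-≥ : ∀ M g → M ≤ stock M g
stock-≥ M zero    = ≤-refl
stock-≥ M (suc g) = m≤n⇒m≤1+n (m≤n⇒m≤1+n (stock-≥ M g))

record Kind : Set where
  constructor kind
  field red-length blue-length size : ℕ

module _ {a : ℕ} where

  record Holds (E : Board a 2) (κ : Kind) (x : Fin a) : Set where
    constructor holds
    open Kind κ
    field
      red-path  : PathFrom E red red-length x
      blue-path : PathFrom E blue blue-length x
      sized     : SizeAtMost E x size

  -- Mutual unreachability lets Builder join any two entries without closing a cycle.
  Pool : Board a 2 → List Kind → Set
  Pool E ks = ∃[ xs ] map proj₁ xs ≡ ks × All (λ (κ , x) → Holds E κ x) xs ×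
              AllPairs (λ p q → ¬ Reach E (proj₂ p) (proj₂ q)) xs

  pool-↭ : ∀ {E ks ls} → ks ↭ ls → Pool E ks → Pool E ls
  pool-↭ ρ (xs , refl , H , S) with ↭-map-inv proj₁ ρ
  ... | ys , eq , σ = ys , sym eq , All-resp-↭ σ H ,
    SetoidPermutation.AllPairs-resp-↭ (setoid _) (λ ¬r → ¬r ∘ reach-sym) (resp₂ _) (↭⇒↭ₛ σ) S

  pool-dropˡ : ∀ {E} ks {ls} → Pool E (ks ++ ls) → Pool E ls
  pool-dropˡ [] p = p
  pool-dropˡ (_ ∷ ks) (_ ∷ xs , eq , _ ∷ H , _ ∷ S) = pool-dropˡ ks (xs , ∷-injectiveʳ eq , H , S)

  pool-dropʳ : ∀ {E} ks {ls} → Pool E (ks ++ ls) → Pool E ks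
  pool-dropʳ ks {ls} p = pool-dropˡ ls (pool-↭ (++-comm ks ls) p)

  pool-replicate : ∀ {E κ ks m n} → m ≤ n → Pool E (replicate n κ ++ ks) → Pool E (replicate m κ ++ ks)
  pool-replicate {ks = ks} {zero} {n} z≤n p = pool-dropˡ (replicate n _) p
  pool-replicate {κ = κ} {ks} {suc m} {suc n} (s≤s le) p =
    pool-↭ (shift κ (replicate m κ) ks)
      (pool-replicate {m = m} {n} le (pool-↭ (↭-sym (shift κ (replicate n κ) ks)) p))

  pool-head : ∀ {E κ ks} → Pool E (κ ∷ ks) → ∃[ x ] Holds E κ x
  pool-head (_ , refl , h ∷ _ , _) = _ , h

  holds-away : ∀ {E u v c κ x} → Away E u v x → Holds E κ x → Holds ((u , v , c) ∷ E) κ x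
  holds-away A (holds p q s) = holds (path-old p) (path-old q) (size-away A s)

  pool-join : ∀ {E κ κ₁ κ₂ c u v w ks} {xs : List (Kind × Fin a)} → map proj₁ xs ≡ ks →
              All (λ (κ , x) → Holds E κ x) xs →
              AllPairs (λ p q → ¬ Reach E (proj₂ p) (proj₂ q)) ((κ₁ , u) ∷ (κ₂ , v) ∷ xs) →
              Holds ((u , v , c) ∷ E) κ w → Reach ((u , v , c) ∷ E) u w → Pool ((u , v , c) ∷ E) (κ ∷ ks)
  pool-join {E} {κ} {c = c} {u} {v} {w} {xs = xs} refl H ((_ ∷ u≁) ∷ v≁ ∷ S) h r =
    (κ , w) ∷ xs , refl ,
    h ∷ All.zipWith (λ (A , h) → holds-away A h) (away , H) ,
    All.map (λ A s → away-new A (reach-trans r s)) away ∷ separate away S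
    where
    away : All (λ p → Away E u v (proj₂ p)) xs
    away = All.zip (u≁ , v≁)
    separate : ∀ {xs : List (Kind × Fin a)} → All (λ p → Away E u v (proj₂ p)) xs →
               AllPairs (λ p q → ¬ Reach E (proj₂ p) (proj₂ q)) xs →
               AllPairs (λ p q → ¬ Reach ((u , v , c) ∷ E) (proj₂ p) (proj₂ q)) xs
    separate [] [] = []
    separate (A ∷ As) (p ∷ S) = All.map (λ ¬r → ¬r ∘ away-reach A) p ∷ separate As S

  module _ (ℓ k : ℕ) where

    Wins : Board a 2 → Set
    Wins = BuilderWinsFrom ℓ k 2

    Ready : Board a 2 → List Kind → Set
    Ready E ks = ComponentsAtMost k E × Pool E ks

    ready-↭ : ∀ {E ks ls} → ks ↭ ls → Ready E ks → Ready E ls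
    ready-↭ ρ (K , p) = K , pool-↭ ρ p

    -- Whatever the colour, one endpoint of the new edge starts both a red and a blue path.
    pair-up : ∀ {E s t m n ks} → suc (m + n) ≤ k →
              (∀ {E} → Ready E (kind s t (suc (m + n)) ∷ ks) → Wins E) →
              Ready E (kind s 0 m ∷ kind 0 t n ∷ ks) → Wins E
    pair-up {E} {s} {t} {m} {n} {ks} ≤k next
      (K , (_ , u) ∷ (_ , v) ∷ xs , refl , holds p _ Su ∷ holds _ q Sv ∷ H , S@((¬uv ∷ _) ∷ _)) =
      present u v ¬uv (λ c → components-∷ Su Sv ≤k K) answer
      where
      answer : ∀ c → Wins ((u , v , c) ∷ E)
      -- Which path gains the new edge depends on the colour; the gain is given up so that both
      -- answers yield the same kind.
      answer red  = next (components-∷ Su Sv ≤k K , pool-join refl H S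
        (holds (weaken (path-cons (¬uv ∘ reach-sym) (inj₂ (here refl)) p)) (path-old q) (size-join Su Sv (inj₂ here)))
        (step (red , inj₁ (here refl)) here))
        where
        weaken : ∀ {E : Board a 2} {x} → PathFrom E red (suc s) x → PathFrom E red s x
        weaken (ys , C , U , le) = ys , C , U , <⇒≤ le
      answer blue = next (components-∷ Su Sv ≤k K , pool-join refl H S
        (holds (path-old p) (weaken (path-cons ¬uv (inj₁ (here refl)) q)) (size-join Su Sv (inj₁ here)))
        here)
        where
        weaken : ∀ {E : Board a 2} {x} → PathFrom E blue (suc t) x → PathFrom E blue t x
        weaken (ys , C , U , le) = ys , C , U , <⇒≤ le

    -- The colour of the joining edge decides which two paths merge. The paths of the other colour
    -- are forgotten, so that the result is again a kind that `pair-up` accepts.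
    double : ∀ {E s t n ks} → suc (n + n) ≤ k →
             (∀ {E} → Ready E (kind (suc (s + s)) 0 (suc (n + n)) ∷ ks) → Wins E) →
             (∀ {E} → Ready E (kind 0 (suc (t + t)) (suc (n + n)) ∷ ks) → Wins E) →
             Ready E (kind s t n ∷ kind s t n ∷ ks) → Wins E
    double {E} {s} {t} {n} ≤k next-red next-blue
      (K , (_ , u) ∷ (_ , v) ∷ xs , refl , holds p q Su ∷ holds p′ q′ Sv ∷ H , S@((¬uv ∷ _) ∷ _)) =
      present u v ¬uv (λ c → components-∷ Su Sv ≤k K) answer
      where
      sized : ∀ {c w} → Reach ((u , v , c) ∷ E) u w → SizeAtMost ((u , v , c) ∷ E) w (suc (n + n))
      sized r L U R = size-join Su Sv (inj₁ here) L U (All.map (reach-trans r) R)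
      answer : ∀ c → Wins ((u , v , c) ∷ E)
      answer red with path-join ¬uv p p′
      ... | w , path , r = next-red (components-∷ Su Sv ≤k K , pool-join refl H S (holds path path-zero (sized r)) r)
      answer blue with path-join ¬uv q q′
      ... | w , path , r = next-blue (components-∷ Su Sv ≤k K , pool-join refl H S (holds path-zero path (sized r)) r)

    -- Two uses of `pair-up` followed by `double`: the step of size 2m + 2n + 3 in the recursion.
    lengthen : ∀ {E s t m n ks} → let d = suc (m + n) in suc (d + d) ≤ k →
           (∀ {E} → Ready E (kind (suc (s + s)) 0 (suc (d + d)) ∷ ks) → Wins E) →
           (∀ {E} → Ready E (kind 0 (suc (t + t)) (suc (d + d)) ∷ ks) → Wins E) →
           Ready E (kind s 0 m ∷ kind s 0 m ∷ kind 0 t n ∷ kind 0 t n ∷ ks) → Wins E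
    lengthen {s = s} {t} {m} {n} {ks} ≤k next-red next-blue R =
      pair-up d≤k (λ R₁ → pair-up d≤k (double ≤k next-red next-blue) (ready-↭ (rotate _ _ _) R₁))
        (ready-↭ (↭-prep _ (↭-swap _ _ ↭-refl)) R)
      where
      d≤k : suc (m + n) ≤ k
      d≤k = ≤-trans (m≤n⇒m≤1+n (m≤m+n _ _)) ≤k
      rotate : ∀ (x y z : Kind) → x ∷ y ∷ z ∷ ks ↭ y ∷ z ∷ x ∷ ks
      rotate x y z = ↭-trans (↭-swap x y ↭-refl) (↭-prep y (↭-swap x z ↭-refl))

    module _ {s t m n : ℕ} where
      private
        d : ℕ
        d = suc (m + n)
        κR κB κR′ κB′ : Kind
        κR = kind s 0 m
        κB = kind 0 t n
        κR′ = kind (suc (s + s)) 0 (suc (d + d))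
        κB′ = kind 0 (suc (t + t)) (suc (d + d))

      Stock : ℕ → ℕ → ℕ → List Kind
      Stock g i j = replicate g κR ++ replicate g κB ++ replicate i κR′ ++ replicate j κB′

      take-two : ∀ g {ks} → replicate (2 + g) κR ++ replicate (2 + g) κB ++ ks ↭
                            κR ∷ κR ∷ κB ∷ κB ∷ replicate g κR ++ replicate g κB ++ ks
      take-two g = ↭-prep _ (↭-prep _ (↭-trans (shift κB (replicate g κR) _) (↭-prep _ (shift κB (replicate g κR) _))))

      put-red : ∀ g i j → κR′ ∷ Stock g i j ↭ Stock g (suc i) j
      put-red g i j = ↭-trans (↭-sym (shift κR′ (replicate g κR) _))
                            (↭-++⁺ˡ (replicate g κR) (↭-sym (shift κR′ (replicate g κB) _)))

      put-blue : ∀ g i j → κB′ ∷ Stock g i j ↭ Stock g i (suc j)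
      put-blue g i j = ↭-trans (↭-sym (shift κB′ (replicate g κR) _))
                       (↭-++⁺ˡ (replicate g κR) (↭-trans (↭-sym (shift κB′ (replicate g κB) _))
                       (↭-++⁺ˡ (replicate g κB) (↭-sym (shift κB′ (replicate i κR′) _)))))

      -- Painter's answers produce κR′ or κB′; Builder repeats until he has N₁ of the former or N₂ of the latter.
      collect : ∀ N₁ N₂ → suc (d + d) ≤ k →
                (∀ {E} → Ready E (replicate N₁ κR′ ++ replicate N₁ κB) → Wins E) →
                (∀ {E} → Ready E (replicate N₂ κR ++ replicate N₂ κB′) → Wins E) →
                ∀ g₁ g₂ i j → i + g₁ ≡ N₁ → j + g₂ ≡ N₂ →
                ∀ {E} → Ready E (Stock (stock (N₁ + N₂) (g₁ + g₂)) i j) → Wins E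
      -- `N₁` longer red paths are ready, and at least `N₁` of the old blue ones remain, since the
      -- stock never falls below `N₁ + N₂`.
      collect N₁ N₂ ≤k next-red next-blue zero g₂ i j eq _ (K , p) rewrite trans (sym (+-identityʳ i)) eq =
        next-red (K , pool-↭ (++-comm (replicate N₁ κB) (replicate N₁ κR′))
          (pool-replicate {m = N₁} (≤-trans (m≤m+n N₁ N₂) (stock-≥ (N₁ + N₂) g₂))
            (pool-dropʳ (replicate G κB ++ replicate N₁ κR′)
              (subst (Pool _) (sym (++-assoc (replicate G κB) (replicate N₁ κR′) _)) (pool-dropˡ (replicate G κR) p)))))
        where
        G = stock (N₁ + N₂) g₂
      collect N₁ N₂ ≤k next-red next-blue (suc g₁) zero i j _ eq (K , p) rewrite trans (sym (+-identityʳ j)) eq =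
        next-blue (K , pool-replicate {m = N₂} (≤-trans (m≤n+m N₂ N₁) (stock-≥ (N₁ + N₂) (suc g₁ + 0)))
          (pool-↭ (++-comm (replicate N₂ κB′) (replicate G κR))
          (pool-dropˡ (replicate G κB ++ replicate i κR′)
            (subst (Pool _) (sym (trans (++-assoc (replicate G κB) (replicate i κR′) _)
                (cong (replicate G κB ++_) (sym (++-assoc (replicate i κR′) (replicate N₂ κB′) (replicate G κR)))))) 
            (subst (Pool _) (++-assoc (replicate G κB) _ _) (pool-↭ (++-comm (replicate G κR) _) p))))))
        where
        G = stock (N₁ + N₂) (suc g₁ + 0)
      collect N₁ N₂ ≤k next-red next-blue (suc g₁) (suc g₂) i j eq₁ eq₂ R =
        lengthen ≤k
          (λ R′ → collect N₁ N₂ ≤k next-red next-blue g₁ (suc g₂) (suc i) j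
                    (trans (sym (+-suc i g₁)) eq₁) eq₂ (ready-↭ (put-red g i j) R′))
          (λ {E} R′ → collect N₁ N₂ ≤k next-red next-blue (suc g₁) g₂ i (suc j)
                    eq₁ (trans (sym (+-suc j g₂)) eq₂)
                    (subst (λ h → Ready E (Stock (stock (N₁ + N₂) h) i (suc j))) (+-suc g₁ g₂)
                       (ready-↭ (put-blue g i j) R′)))
          (ready-↭ (take-two g) R)
        where g = stock (N₁ + N₂) (g₁ + suc g₂)

-- The cost recursion and the number of doublings

cost : ℕ → ℕ
cost zero          = 0
cost (suc zero)    = 0
-- After adding 1 this is z(n+2) = 2 z(n+1) + 2 z(n). Both initial kinds are isolated vertices,
-- hence the two zeros.
cost (suc (suc n)) = let d = suc (cost n + cost (suc n)) in suc (d + d)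

cost-suc : ∀ n → cost n ≤ cost (suc n)
cost-suc zero    = z≤n
cost-suc (suc n) = m≤n⇒m≤1+n (≤-trans (m≤n⇒m≤1+n (m≤n+m (cost (suc n)) (cost n))) (m≤m+n _ _))

cost-mono : ∀ {m n} → m ≤ n → cost m ≤ cost n
cost-mono {m} m≤n = go (≤⇒≤′ m≤n)
  where
  go : ∀ {n} → m ≤′ n → cost m ≤ cost n
  go ≤′-refl     = ≤-refl
  go (≤′-step p) = ≤-trans (go p) (cost-suc _)

halve : ∀ ℓ p s → suc ℓ ≤ 2 ^ suc p * suc s → suc ℓ ≤ 2 ^ p * suc (suc (s + s))
halve ℓ p s = subst (suc ℓ ≤_) (eq (2 ^ p) s)
  where
  eq : ∀ x s → 2 * x * suc s ≡ x * suc (suc (s + s))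
  eq = solve-∀

-- Red paths of length s can still be doubled p times before they reach length ℓ, and blue ones q times.
strategy : ∀ ℓ H p q {s t m n} b → suc ℓ ≤ 2 ^ p * suc s → suc ℓ ≤ 2 ^ q * suc t → b + (p + q) ≤ H →
           m ≤ cost (suc b) → n ≤ cost (suc b) → m + n ≤ cost b + cost (suc b) →
           ∃[ N ] ∀ {a} {E : Board a 2} → Ready ℓ (cost H) E (replicate N (kind s 0 m) ++ replicate N (kind 0 t n)) →
                  BuilderWinsFrom ℓ (cost H) 2 E
strategy ℓ H zero q {s} b ℓ≤ _ _ _ _ _ = 1 , λ (_ , P) →
  painterLost (path⇒monoPath (s≤s⁻¹ (subst (suc ℓ ≤_) (+-identityʳ (suc s)) ℓ≤)) (Holds.red-path (proj₂ (pool-head P))))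
strategy ℓ H (suc p) zero {t = t} b _ ℓ≤ _ _ _ _ = 1 , λ (_ , P) →
  painterLost (path⇒monoPath (s≤s⁻¹ (subst (suc ℓ ≤_) (+-identityʳ (suc t)) ℓ≤))
    (Holds.blue-path (proj₂ (pool-head (pool-dropˡ (_ ∷ []) P)))))
strategy ℓ H (suc p) (suc q) {s} {t} {m} {n} b ℓ≤s ℓ≤t b≤ m≤ n≤ mn≤
  with strategy ℓ H p (suc q) {suc (s + s)} {t} {suc (suc (m + n) + suc (m + n))} {n} (suc b)
         (halve ℓ p s ℓ≤s) ℓ≤t (subst (_≤ H) (+-suc b (p + suc q)) b≤) D≤ n≤′
         (≤-trans (+-mono-≤ D≤ n≤) (≤-reflexive (+-comm (cost (2 + b)) _)))
     | strategy ℓ H (suc p) q {s} {suc (t + t)} {m} {suc (suc (m + n) + suc (m + n))} (suc b)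
         ℓ≤s (halve ℓ q t ℓ≤t) (subst (_≤ H) (trans (cong (λ x → b + suc x) (+-suc p q)) (+-suc b (suc p + q))) b≤)
         m≤′ D≤ (+-mono-≤ m≤ D≤)
  where
  -- The separate bound on `m + n` records that the last doubling enlarged only one of the two
  -- kinds; it is what brings `cost b` into the recursion.
  D≤ : suc (suc (m + n) + suc (m + n)) ≤ cost (2 + b)
  D≤ = s≤s (+-mono-≤ (s≤s mn≤) (s≤s mn≤))
  n≤′ = ≤-trans n≤ (cost-suc (suc b))
  m≤′ = ≤-trans m≤ (cost-suc (suc b))
... | N₁ , win₁ | N₂ , win₂ = G , λ {_} {E} (K , P) →
    collect ℓ (cost H) N₁ N₂ (≤-trans D≤ (cost-mono (≤-trans 2+b≤ b≤))) win₁ win₂ N₁ N₂ 0 0 refl refl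
      (K , subst (λ ks → Pool E (replicate G (kind s 0 m) ++ ks)) (sym (++-identityʳ _)) P)
  where
  G = stock (N₁ + N₂) (N₁ + N₂)
  D≤ : suc (suc (m + n) + suc (m + n)) ≤ cost (2 + b)
  D≤ = s≤s (+-mono-≤ (s≤s mn≤) (s≤s mn≤))
  2+b≤ : 2 + b ≤ b + (suc p + suc q)
  2+b≤ = ≤-trans (≤-reflexive (+-comm 2 b)) (+-monoʳ-≤ b (s≤s (≤-trans (s≤s z≤n) (m≤n+m (suc q) p))))

isolated-pool : ∀ N → Pool {N + N} [] (replicate N (kind 0 0 0) ++ replicate N (kind 0 0 0))
isolated-pool N = tabulate (λ i → kind 0 0 0 , i) , kinds N ,
  All-tabulate⁺ (λ i → holds path-zero path-zero (λ { [] _ _ → z≤n })) ,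
  AllPairs-tabulate⁺ (λ { i≢j here → i≢j refl ; _ (step (_ , inj₁ ()) _) ; _ (step (_ , inj₂ ()) _) })
  where
  κ = kind 0 0 0
  one : ∀ {a} n (f : Fin n → Fin a) → map proj₁ (tabulate {A = Kind × Fin a} (λ i → κ , f i)) ≡ replicate n κ
  one zero    f = refl
  one (suc n) f = cong (κ ∷_) (one n (f ∘ suc))
  replicate-+ : ∀ m n → replicate (m + n) κ ≡ replicate m κ ++ replicate n κ
  replicate-+ zero    n = refl
  replicate-+ (suc m) n = cong (κ ∷_) (replicate-+ m n)
  kinds : ∀ N → map proj₁ (tabulate {A = Kind × Fin (N + N)} (λ i → κ , i)) ≡ replicate N κ ++ replicate N κ
  kinds N = trans (one (N + N) id) (replicate-+ N N)

builder-wins : ∀ ℓ h → suc ℓ ≤ 2 ^ h → BuilderWins ℓ (cost (h + h)) 2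
builder-wins ℓ h ℓ< with strategy ℓ (h + h) h h {0} {0} {0} {0} 0 ℓ<′ ℓ<′ ≤-refl z≤n z≤n z≤n
  where ℓ<′ = subst (suc ℓ ≤_) (sym (*-identityʳ (2 ^ h))) ℓ<
... | N , win = N + N , win ((λ { w [] _ _ → z≤n }) , isolated-pool N)

-- `suc (cost n)` is the rational part of the n-th power of 1 + √3, and two steps multiply by 4 +
-- 2√3.
cost-xs : ∀ h → suc (cost (h + h)) ≡ xs h × suc (cost (suc (h + h))) ≡ xs h + 3 * ys h
cost-xs zero = refl , refl
cost-xs (suc h) rewrite +-suc h h with cost-xs h
... | p , q = even , odd
  where
  z z′ : ℕ
  z  = cost (h + h)
  z′ = cost (suc (h + h))
  even : suc (cost (2 + (h + h))) ≡ xs (suc h)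
  even = trans (e₁ z z′) (trans (cong₂ (λ x y → 2 * x + 2 * y) p q) (e₂ (xs h) (ys h)))
    where
    e₁ : ∀ z z′ → suc (suc (suc (z + z′) + suc (z + z′))) ≡ 2 * suc z + 2 * suc z′
    e₁ = solve-∀
    e₂ : ∀ x y → 2 * x + 2 * (x + 3 * y) ≡ 4 * x + 6 * y
    e₂ = solve-∀
  odd : suc (cost (3 + (h + h))) ≡ xs (suc h) + 3 * ys (suc h)
  odd = trans (e₁ z′ (cost (2 + (h + h)))) (trans (cong₂ (λ x y → 2 * x + 2 * y) q even) (e₂ (xs h) (ys h)))
    where
    e₁ : ∀ z z′ → suc (suc (suc (z + z′) + suc (z + z′))) ≡ 2 * suc z + 2 * suc z′
    e₁ = solve-∀
    e₂ : ∀ x y → 2 * (x + 3 * y) + 2 * (4 * x + 6 * y) ≡ 4 * x + 6 * y + 3 * (2 * x + 4 * y)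
    e₂ = solve-∀

log₂ : ∀ ℓ → ∃[ h ] 2 ^ h ≤ suc ℓ × suc (suc ℓ) ≤ 2 ^ suc h
log₂ zero = 0 , ≤-refl , ≤-refl
log₂ (suc ℓ) with log₂ ℓ
... | h , lo , hi with ≤-<-connex (3 + ℓ) (2 ^ suc h)
...   | inj₁ le = h , m≤n⇒m≤1+n lo , le
...   | inj₂ gt = suc h , s≤s⁻¹ gt ,
  subst (3 + ℓ ≤_) (cong (2 ^ suc h +_) (sym (+-identityʳ (2 ^ suc h)))) (+-mono-≤ (m^n>0 2 (suc h)) hi)

ys≤xs : ∀ h → ys h ≤ xs h
ys≤xs zero    = z≤n
ys≤xs (suc h) = +-mono-≤ (*-monoˡ-≤ (xs h) (≤ᵇ⇒≤ 2 4 _)) (*-monoˡ-≤ (ys h) (≤ᵇ⇒≤ 4 6 _))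

-- The exponent

-- n ≥ x + y√3
GeSurd : ℕ → ℕ → ℕ → Set
GeSurd n x y = ∃[ d ] n ≡ x + d × 3 * (y * y) ≤ d * d

square-cancel-≤ : ∀ {m n} → m * m ≤ n * n → m ≤ n
square-cancel-≤ {m} {n} le with ≤-<-connex m n
... | inj₁ p = p
... | inj₂ p = ⊥-elim (<⇒≱ (*-mono-< p p) le)

-- With surpluses d ≥ y√3 and d′ ≥ y′√3, the product dd′ covers the rational term 3yy′ and leaves
-- `e`; the remaining surplus xd′ + dx′ + e dominates (xy′ + yx′)√3 term by term.
geSurd-* : ∀ {n x y n′ x′ y′} → GeSurd n x y → GeSurd n′ x′ y′ →
           GeSurd (n * n′) (x * x′ + 3 * (y * y′)) (x * y′ + y * x′)
geSurd-* {x = x} {y} {x′ = x′} {y′} (d , refl , le) (d′ , refl , le′) with m≤n⇒∃[o]m+o≡n cross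
  where
  open ≤-Reasoning
  cross : 3 * (y * y′) ≤ d * d′
  cross = square-cancel-≤ (begin
    3 * (y * y′) * (3 * (y * y′))      ≡⟨ e₁ y y′ ⟩
    3 * (y * y) * (3 * (y′ * y′))      ≤⟨ *-mono-≤ le le′ ⟩
    d * d * (d′ * d′)                  ≡⟨ e₂ d d′ ⟩
    d * d′ * (d * d′)                  ∎)
    where
    e₁ : ∀ y y′ → 3 * (y * y′) * (3 * (y * y′)) ≡ 3 * (y * y) * (3 * (y′ * y′))
    e₁ = solve-∀
    e₂ : ∀ d d′ → d * d * (d′ * d′) ≡ d * d′ * (d * d′)
    e₂ = solve-∀
... | e , eq = x * d′ + d * x′ + e , product , bound
  where
  open ≤-Reasoning
  product : (x + d) * (x′ + d′) ≡ x * x′ + 3 * (y * y′) + (x * d′ + d * x′ + e)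
  product = trans (e₁ x d x′ d′) (trans (cong (λ z → x * x′ + (x * d′ + d * x′) + z) (sym eq))
                                            (e₂ (x * x′) (x * d′ + d * x′) (3 * (y * y′)) e))
    where
    e₁ : ∀ x d x′ d′ → (x + d) * (x′ + d′) ≡ x * x′ + (x * d′ + d * x′) + d * d′
    e₁ = solve-∀
    e₂ : ∀ a b c e → a + b + (c + e) ≡ a + c + (b + e)
    e₂ = solve-∀
  cross : 3 * (y * y′) ≤ d * d′
  cross = subst (3 * (y * y′) ≤_) eq (m≤m+n _ e)
  bound : 3 * ((x * y′ + y * x′) * (x * y′ + y * x′)) ≤ (x * d′ + d * x′ + e) * (x * d′ + d * x′ + e)
  bound = begin
    3 * ((x * y′ + y * x′) * (x * y′ + y * x′))
      ≡⟨ e₁ x y x′ y′ ⟩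
    x * x * (3 * (y′ * y′)) + x′ * x′ * (3 * (y * y)) + 2 * (x * x′) * (3 * (y * y′))
      ≤⟨ +-mono-≤ (+-mono-≤ (*-monoʳ-≤ (x * x) le′) (*-monoʳ-≤ (x′ * x′) le)) (*-monoʳ-≤ (2 * (x * x′)) cross) ⟩
    x * x * (d′ * d′) + x′ * x′ * (d * d) + 2 * (x * x′) * (d * d′)
      ≡⟨ e₂ x d x′ d′ ⟩
    (x * d′ + d * x′) * (x * d′ + d * x′)
      ≤⟨ *-mono-≤ (m≤m+n (x * d′ + d * x′) e) (m≤m+n (x * d′ + d * x′) e) ⟩
    (x * d′ + d * x′ + e) * (x * d′ + d * x′ + e) ∎
    where
    e₁ : ∀ x y x′ y′ → 3 * ((x * y′ + y * x′) * (x * y′ + y * x′)) ≡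
         x * x * (3 * (y′ * y′)) + x′ * x′ * (3 * (y * y)) + 2 * (x * x′) * (3 * (y * y′))
    e₁ = solve-∀
    e₂ : ∀ x d x′ d′ → x * x * (d′ * d′) + x′ * x′ * (d * d) + 2 * (x * x′) * (d * d′) ≡
         (x * d′ + d * x′) * (x * d′ + d * x′)
    e₂ = solve-∀

surd-+ : ∀ i j → xs (i + j) ≡ xs i * xs j + 3 * (ys i * ys j) × ys (i + j) ≡ xs i * ys j + ys i * xs j
surd-+ zero j = sym (trans (+-identityʳ _) (+-identityʳ _)) , sym (trans (+-identityʳ _) (+-identityʳ _))
surd-+ (suc i) j with surd-+ i j
... | p , q = trans (cong₂ (λ u v → 4 * u + 6 * v) p q) (e₁ (xs i) (ys i) (xs j) (ys j)) ,
              trans (cong₂ (λ u v → 2 * u + 4 * v) p q) (e₂ (xs i) (ys i) (xs j) (ys j))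
  where
  e₁ : ∀ a b c d → 4 * (a * c + 3 * (b * d)) + 6 * (a * d + b * c) ≡ (4 * a + 6 * b) * c + 3 * ((2 * a + 4 * b) * d)
  e₁ = solve-∀
  e₂ : ∀ a b c d → 2 * (a * c + 3 * (b * d)) + 4 * (a * d + b * c) ≡ (4 * a + 6 * b) * d + (2 * a + 4 * b) * c
  e₂ = solve-∀

geSurd-^ : ∀ {n b} → GeSurd n (xs b) (ys b) → ∀ h → GeSurd (n ^ h) (xs (h * b)) (ys (h * b))
geSurd-^ G zero = 0 , refl , z≤n
geSurd-^ {n} {b} G (suc h) rewrite proj₁ (surd-+ b (h * b)) | proj₂ (surd-+ b (h * b)) =
  geSurd-* {y = ys b} G (geSurd-^ {n} {b} G h)

xs-^ : ∀ h b → xs h ^ b ≤ xs (b * h)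
xs-^ h zero    = ≤-refl
xs-^ h (suc b) = begin
  xs h * xs h ^ b                                ≤⟨ *-monoʳ-≤ (xs h) (xs-^ h b) ⟩
  xs h * xs (b * h)                              ≤⟨ m≤m+n _ _ ⟩
  xs h * xs (b * h) + 3 * (ys h * ys (b * h))    ≡⟨ sym (proj₁ (surd-+ h (b * h))) ⟩
  xs (h + b * h)                                 ∎
  where open ≤-Reasoning

^-distribʳ-* : ∀ n x y → (x * y) ^ n ≡ x ^ n * y ^ n
^-distribʳ-* zero    x y = refl
^-distribʳ-* (suc n) x y = trans (cong (x * y *_) (^-distribʳ-* n x y)) (eq x y (x ^ n) (y ^ n))
  where
  eq : ∀ x y u v → x * y * (u * v) ≡ x * u * (y * v)
  eq = solve-∀

-- Raising `2 ^ a` > (4 + 2√3)^(b+1) to the power `h` and using `2 ^ h ≤ ℓ` shows that `ℓ ^ a` is at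
-- least `xs h ^ suc b`.
xs-leCPowAlpha : ∀ {ℓ k} h → 2 ^ h ≤ ℓ → k ≤ 10 * xs h → LeCPowAlpha 10 ℓ k
xs-leCPowAlpha {ℓ} {k} h h≤ k≤ a b (d , eq , gt) = begin
  k ^ suc b                        ≤⟨ ^-monoˡ-≤ (suc b) k≤ ⟩
  (10 * xs h) ^ suc b              ≡⟨ ^-distribʳ-* (suc b) 10 (xs h) ⟩
  10 ^ suc b * xs h ^ suc b        ≤⟨ *-monoʳ-≤ (10 ^ suc b) power ⟩
  10 ^ suc b * ℓ ^ a               ∎
  where
  open ≤-Reasoning
  power : xs h ^ suc b ≤ ℓ ^ a
  power with geSurd-^ {2 ^ a} {suc b} (suc d , eq , <⇒≤ gt) h
  ... | e , eq′ , _ = begin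
    xs h ^ suc b                   ≤⟨ xs-^ h (suc b) ⟩
    xs (suc b * h)                 ≡⟨ cong xs (*-comm (suc b) h) ⟩
    xs (h * suc b)                 ≤⟨ m≤m+n _ e ⟩
    xs (h * suc b) + e             ≡⟨ sym eq′ ⟩
    (2 ^ a) ^ h                    ≡⟨ ^-*-assoc 2 a h ⟩
    2 ^ (a * h)                    ≡⟨ cong (2 ^_) (*-comm a h) ⟩
    2 ^ (h * a)                    ≡⟨ sym (^-*-assoc 2 h a) ⟩
    (2 ^ h) ^ a                    ≤⟨ ^-monoˡ-≤ a h≤ ⟩
    ℓ ^ a                          ∎

upper-bound : ∃[ C ] ∃[ L ] ∀ (ℓ : ℕ) → L ≤ ℓ → ∃[ k ] (BuilderWins ℓ k 2 × LeCPowAlpha C ℓ k)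
upper-bound = 10 , 1 , bound
  where
  bound : ∀ (ℓ : ℕ) → 1 ≤ ℓ → ∃[ k ] (BuilderWins ℓ k 2 × LeCPowAlpha 10 ℓ k)
  bound (suc ℓ) _ with log₂ ℓ
  ... | h , lo , hi = cost (suc h + suc h) , builder-wins (suc ℓ) (suc h) hi , xs-leCPowAlpha h lo (begin
    cost (suc h + suc h)          ≤⟨ n≤1+n _ ⟩
    suc (cost (suc h + suc h))    ≡⟨ proj₁ (cost-xs (suc h)) ⟩
    -- Rounding up to `2 ^ suc h` costs one more factor 4 + 2√3; in terms of `xs h` it is at most 10
    -- = 4 + 6.
    4 * xs h + 6 * ys h           ≤⟨ +-monoʳ-≤ (4 * xs h) (*-monoʳ-≤ 6 (ys≤xs h)) ⟩
    4 * xs h + 6 * xs h           ≡⟨ sym (*-distribʳ-+ (xs h) 4 6) ⟩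
    10 * xs h                     ∎)
    where open ≤-Reasoning

theorem6 : (∀ (p q : ℕ) → 15 * p < 8 * suc q →
    ∃[ L ] ∀ (ℓ k : ℕ) → L ≤ ℓ → BuilderWins ℓ k 2 → p * (ℓ ^ 2) ≤ suc q * k)
    ×
    (∃[ C ] ∃[ L ] ∀ (ℓ : ℕ) → L ≤ ℓ → ∃[ k ] (BuilderWins ℓ k 2 × LeCPowAlpha C ℓ k))
theorem6 = lower-bound , upper-bound
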